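{- For every integer $k\ge1$, $$E^{k(k-1)\cdots1}_{3\text{ - }12}(x)=\begin{cases}e^{e^x}\displaystyle\int_0^x e^{ -e^t}\sum_{n\ge k-1}\frac{t^n}{n!}\,dt,&\text{if }k\ge2,\\[2mm] e^{e^x-1},&\text{if }k=1.\end{cases}$$
   Context: A permutation $\pi=\pi_1\cdots\pi_n$ of $\{1,\dots,n\}$ contains the generalized pattern $3\text{ - }12$ if there are indices $i<j<n$ such that $\pi_i\pi_j\pi_{j+1}$ is order-isomorphic to $312$; otherwise it avoids it. A permutation $\pi$ begins with a pattern $p=p_1\cdots p_k$ if $n\ge k$ and $\pi_1\cdots\pi_k$ is order-isomorphic to $p$; by convention, the empty permutation is also regarded as beginning with the pattern $1$ (the case $k=1$). $E^p_q(x)=\sum_{n\ge0}N^p_q(n)\frac{x^n}{n!}$, where $N^p_q(n)$ is the number of permutations of $\{1,\dots,n\}$ that avoid $q$ and begin with $p$. Identities are identities of power series in $x$. -}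

module Defs where

open import Algebra.Bundles.Raw using (RawRing)
import Algebra.Definitions.RawMonoid as RawSum
import Algebra.Definitions.RawSemiring as RawPower
open import Data.Bool.Base using (if_then_else_)
open import Data.Fin.Base as Fin using (Fin; toℕ; inject≤; opposite)
open import Data.Fin using (#_)
import Data.Fin.Properties as Fin
import Data.Integer.Base as ℤ
import Data.Integer.Properties as ℤ
import Data.Nat.Tactic.RingSolver as ℕ-Solver
open import Data.List.Base as List
  using (List; allFin; cartesianProductWith; filter; length)
open import Data.Nat.Base as ℕ using (ℕ; zero; suc; _!; z≤n; s≤s)
import Data.Nat.Properties as ℕ
open import Data.Product.Base using (∃; _×_; _,_; proj₁; proj₂)
open import Data.Rational.Base as ℚ using (ℚ; 0ℚ; 1ℚ; ½; ∣_∣)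
import Data.Rational.Properties as ℚ
open import Data.Rational.Solver using (module +-*-Solver)
open import Data.Rational.Unnormalised.Base as ℚᵘ using (mkℚᵘ)
import Data.Rational.Unnormalised.Properties as ℚᵘ
open import Data.Sum.Base using (_⊎_)
open import Data.Vec.Base using (Vec; []; _∷_; lookup; tabulate)
open import Data.Vec.Relation.Unary.AllPairs using (allPairs?)
open import Data.Vec.Relation.Unary.Unique.Propositional using (Unique)
open import Function.Base using (_∘_)
open import Function.Bundles using (_⇔_; mk⇔; module Equivalence)
open import Level using (0ℓ)
open import Relation.Binary.PropositionalEquality
  using (_≡_; refl; sym; trans; cong; cong₂; subst; subst₂)
open import Relation.Nullary using (Dec; yes; no; ¬_)
open import Relation.Nullary.Decidable using (map′; _×-dec_; _⊎-dec_; _→-dec_; ¬?)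
open import Relation.Unary using (Decidable)

------------------------------------------------------------------------
-- Permutations and patterns

-- Words are written over Fin n rather than {1,…,n}: all values are shifted
-- down by one, which does not affect order-isomorphism.

Word : ℕ → ℕ → Set
Word n m = Vec (Fin n) m

words : ∀ n m → List (Word n m)
words n zero    = [] List.∷ List.[]
words n (suc m) = cartesianProductWith _∷_ (allFin n) (words n m)

-- An injective word of length n over an n-letter alphabet is a permutation
-- in one-line notation.

IsPermutation : ∀ {n} → Word n n → Set
IsPermutation = Unique

OrderIsomorphic : ∀ {a b k} → Word a k → Word b k → Set
OrderIsomorphic u v =
  ∀ i j → (lookup u i Fin.< lookup u j) ⇔ (lookup v i Fin.< lookup v j)

p312 : Word 3 3
p312 = # 2 ∷ # 0 ∷ # 1 ∷ []

Contains3-12 : ∀ {n} → Word n n → Set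
Contains3-12 {n} π = ∃ λ (i : Fin n) → ∃ λ (j : Fin n) → ∃ λ (j⁺ : Fin n) →
  i Fin.< j × toℕ j⁺ ≡ suc (toℕ j) ×
  OrderIsomorphic (lookup π i ∷ lookup π j ∷ lookup π j⁺ ∷ []) p312

Avoids3-12 : ∀ {n} → Word n n → Set
Avoids3-12 π = ¬ Contains3-12 π

-- The second disjunct is the convention that the empty permutation begins
-- with the pattern 1.

BeginsWith : ∀ {k n} → Word k k → Word n n → Set
BeginsWith {k} {n} p π =
  (∃ λ (k≤n : k ℕ.≤ n) →
     OrderIsomorphic (tabulate (λ i → lookup π (inject≤ i k≤n))) p)
  ⊎ (k ≡ 1 × n ≡ 0)

descending : ∀ k → Word k k
descending k = tabulate opposite

isPermutation? : ∀ {n} → Decidable (IsPermutation {n})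
isPermutation? = allPairs? (λ x y → ¬? (x Fin.≟ y))

orderIsomorphic? : ∀ {a b k} (u : Word a k) (v : Word b k) →
                   Dec (OrderIsomorphic u v)
orderIsomorphic? u v = Fin.all? λ i → Fin.all? λ j →
  let P? = lookup u i Fin.<? lookup u j
      Q? = lookup v i Fin.<? lookup v j
  in map′ (λ (f , g) → mk⇔ f g)
          (λ e → Equivalence.to e , Equivalence.from e)
          ((P? →-dec Q?) ×-dec (Q? →-dec P?))

avoids3-12? : ∀ {n} → Decidable (Avoids3-12 {n})
avoids3-12? π = ¬? (Fin.any? λ i → Fin.any? λ j → Fin.any? λ j⁺ →
  (i Fin.<? j) ×-dec (toℕ j⁺ ℕ.≟ suc (toℕ j)) ×-dec
  orderIsomorphic? (lookup π i ∷ lookup π j ∷ lookup π j⁺ ∷ []) p312)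

beginsWith? : ∀ {k n} (p : Word k k) → Decidable (BeginsWith {k} {n} p)
beginsWith? {k} {n} p π = prefix? ⊎-dec ((k ℕ.≟ 1) ×-dec (n ℕ.≟ 0))
  where
  Prefix : k ℕ.≤ n → Set
  Prefix k≤n = OrderIsomorphic (tabulate (λ i → lookup π (inject≤ i k≤n))) p

  prefix? : Dec (∃ Prefix)
  prefix? with k ℕ.≤? n
  ... | no k≰n  = no (k≰n ∘ proj₁)
  ... | yes k≤n = map′ (k≤n ,_)
    (λ (k≤n′ , o) → subst Prefix (ℕ.≤-irrelevant k≤n′ k≤n) o)
    (orderIsomorphic? (tabulate (λ i → lookup π (inject≤ i k≤n))) p)

N : ∀ {k} → Word k k → ℕ → ℕ
N p n = length (filter good? (words n n))
  where
  good? : Decidable (λ (π : Word n n) →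
            IsPermutation π × Avoids3-12 π × BeginsWith p π)
  good? π = isPermutation? π ×-dec avoids3-12? π ×-dec beginsWith? p π

------------------------------------------------------------------------
-- Formal power series, as coefficient sequences

module _ (R : RawRing 0ℓ 0ℓ) where
  open RawRing R
  open RawSum +-rawMonoid using (sum)

  ∑ : ℕ → (ℕ → Carrier) → Carrier
  ∑ n f = sum {n} (f ∘ toℕ)

  powerSeries : RawRing 0ℓ 0ℓ
  powerSeries = record
    { Carrier = ℕ → Carrier
    ; _≈_     = λ f g → ∀ n → f n ≈ g n
    ; _+_     = λ f g n → f n + g n
    ; _*_     = λ f g n → ∑ (suc n) (λ i → f i * g (n ℕ.∸ i))
    ; -_      = λ f n → - f n
    ; 0#      = λ _ → 0#
    ; 1#      = λ { zero → 1# ; (suc _) → 0# }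
    }

module ℚ⟦X⟧ where
  open RawRing (powerSeries ℚ.+-*-rawRing) public
  open RawPower rawSemiring public using (_^_)

  infixl 6 _-_

  _-_ : Carrier → Carrier → Carrier
  f - g = f + - g

ℚ⟦X⟧ : Set
ℚ⟦X⟧ = ℚ⟦X⟧.Carrier

1/_! : ℕ → ℚ
1/ n ! = (ℤ.+ 1 ℚ./ n !) {{n ℕ.!≢0}}

eˣ : ℚ⟦X⟧
eˣ n = 1/ n !

-- ∑_{n≥m} xⁿ/n!
eˣ-from : ℕ → ℚ⟦X⟧
eˣ-from m n = if m ℕ.≤ᵇ n then 1/ n ! else 0ℚ

------------------------------------------------------------------------
-- Real numbers, as Cauchy sequences of rationals

-- These are needed because e^{e^x} has constant term e.

Cauchy : (ℕ → ℚ) → Set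
Cauchy x = ∀ ε → 0ℚ ℚ.< ε →
  ∃ λ k → ∀ m n → k ℕ.≤ m → k ℕ.≤ n → ∣ x m ℚ.- x n ∣ ℚ.< ε

record ℝ : Set where
  constructor mkℝ
  field
    approx : ℕ → ℚ
    cauchy : Cauchy approx

open ℝ public

infix 4 _≈ᴿ_

_≈ᴿ_ : ℝ → ℝ → Set
x ≈ᴿ y = ∀ ε → 0ℚ ℚ.< ε →
  ∃ λ k → ∀ n → k ℕ.≤ n → ∣ approx x n ℚ.- approx y n ∣ ℚ.< ε

module CauchyLemmas where
  open +-*-Solver

  neg-sub : ∀ p q → ℚ.- (p ℚ.- q) ≡ q ℚ.- p
  neg-sub = solve 2 (λ p q → :- (p :- q) := q :- p) refl

  sub-neg : ∀ p q → q ℚ.- p ≡ (ℚ.- p) ℚ.- (ℚ.- q)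
  sub-neg = solve 2 (λ p q → q :- p := (:- p) :- (:- q)) refl

  sub-add : ∀ p q → p ≡ q ℚ.+ (p ℚ.- q)
  sub-add = solve 2 (λ p q → p := q :+ (p :- q)) refl

  add-sub : ∀ p q → (p ℚ.+ q) ℚ.- p ≡ q
  add-sub = solve 2 (λ p q → (p :+ q) :- p := q) refl

  sub-sub : ∀ p q s → p ℚ.- q ≡ (p ℚ.- s) ℚ.+ (s ℚ.- q)
  sub-sub = solve 3 (λ p q s → p :- q := (p :- s) :+ (s :- q)) refl

  sub-sub′ : ∀ p q s → p ℚ.- q ≡ (s ℚ.- q) ℚ.+ (p ℚ.- s)
  sub-sub′ = solve 3 (λ p q s → p :- q := (s :- q) :+ (p :- s)) refl

  +-sub : ∀ p q s t → (p ℚ.+ q) ℚ.- (s ℚ.+ t) ≡ (p ℚ.- s) ℚ.+ (q ℚ.- t)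
  +-sub = solve 4 (λ p q s t → (p :+ q) :- (s :+ t) := (p :- s) :+ (q :- t)) refl

  *-sub : ∀ p q s t → p ℚ.* q ℚ.- s ℚ.* t ≡ p ℚ.* (q ℚ.- t) ℚ.+ t ℚ.* (p ℚ.- s)
  *-sub = solve 4 (λ p q s t →
    p :* q :- s :* t := p :* (q :- t) :+ t :* (p :- s)) refl

  half-pos : ∀ {ε} → 0ℚ ℚ.< ε → 0ℚ ℚ.< ½ ℚ.* ε
  half-pos {ε} 0<ε = subst (ℚ._< ½ ℚ.* ε) (ℚ.*-zeroʳ ½) (ℚ.*-monoʳ-<-pos ½ 0<ε)

  half+half : ∀ ε → ½ ℚ.* ε ℚ.+ ½ ℚ.* ε ≡ ε
  half+half ε = trans (sym (ℚ.*-distribʳ-+ ε ½ ½)) (ℚ.*-identityˡ ε)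

  ∣-∣-comm : ∀ p q → ∣ p ℚ.- q ∣ ≡ ∣ q ℚ.- p ∣
  ∣-∣-comm p q = trans (sym (ℚ.∣-p∣≡∣p∣ (p ℚ.- q)))
    (cong ∣_∣ (neg-sub p q))

  +-cauchy : ∀ x y → Cauchy x → Cauchy y → Cauchy (λ n → x n ℚ.+ y n)
  +-cauchy x y cx cy ε 0<ε =
    let k , hx = cx (½ ℚ.* ε) (half-pos 0<ε)
        l , hy = cy (½ ℚ.* ε) (half-pos 0<ε)
    in k ℕ.⊔ l , λ m n km kn → begin-strict
      ∣ (x m ℚ.+ y m) ℚ.- (x n ℚ.+ y n) ∣
        ≡⟨ cong ∣_∣ (+-sub (x m) (y m) (x n) (y n)) ⟩
      ∣ (x m ℚ.- x n) ℚ.+ (y m ℚ.- y n) ∣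
        ≤⟨ ℚ.∣p+q∣≤∣p∣+∣q∣ (x m ℚ.- x n) (y m ℚ.- y n) ⟩
      ∣ x m ℚ.- x n ∣ ℚ.+ ∣ y m ℚ.- y n ∣
        <⟨ ℚ.+-mono-< (hx m n (ℕ.m⊔n≤o⇒m≤o k l km) (ℕ.m⊔n≤o⇒m≤o k l kn))
                      (hy m n (ℕ.m⊔n≤o⇒n≤o k l km) (ℕ.m⊔n≤o⇒n≤o k l kn)) ⟩
      ½ ℚ.* ε ℚ.+ ½ ℚ.* ε ≡⟨ half+half ε ⟩
      ε ∎
    where open ℚ.≤-Reasoning

  neg-cauchy : ∀ x → Cauchy x → Cauchy (λ n → ℚ.- x n)
  neg-cauchy x cx ε 0<ε =
    let k , hx = cx ε 0<ε
    in k , λ m n km kn → subst (ℚ._< ε)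
      (trans (∣-∣-comm (x m) (x n))
        (cong ∣_∣ (sub-neg (x m) (x n))))
      (hx m n km kn)

  bounded : ∀ x → Cauchy x → ∃ λ B → ℚ.Positive B ×
            ∃ λ k → ∀ n → k ℕ.≤ n → ∣ x n ∣ ℚ.≤ B
  bounded x cx =
    let k , hx = cx 1ℚ (ℚ.positive⁻¹ 1ℚ)
    in ∣ x k ∣ ℚ.+ 1ℚ
     , ℚ.nonNeg+pos⇒pos ∣ x k ∣ {{ℚ.∣-∣-nonNeg (x k)}} 1ℚ
     , k , λ n kn → begin
      ∣ x n ∣
        ≡⟨ cong ∣_∣ (sub-add (x n) (x k)) ⟩
      ∣ x k ℚ.+ (x n ℚ.- x k) ∣
        ≤⟨ ℚ.∣p+q∣≤∣p∣+∣q∣ (x k) (x n ℚ.- x k) ⟩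
      ∣ x k ∣ ℚ.+ ∣ x n ℚ.- x k ∣
        ≤⟨ ℚ.+-monoʳ-≤ ∣ x k ∣ (ℚ.<⇒≤ (hx n k kn ℕ.≤-refl)) ⟩
      ∣ x k ∣ ℚ.+ 1ℚ ∎
    where open ℚ.≤-Reasoning

  shrink : ∀ B ε → ℚ.Positive B → 0ℚ ℚ.< ε → ∃ λ δ → 0ℚ ℚ.< δ × B ℚ.* δ ≡ ε
  shrink B ε B>0 0<ε =
    1/B ℚ.* ε
    , subst (ℚ._< 1/B ℚ.* ε) (ℚ.*-zeroʳ 1/B)
        (ℚ.*-monoʳ-<-pos 1/B {{ℚ.1/pos⇒pos B {{B>0}}}} 0<ε)
    , trans (sym (ℚ.*-assoc B 1/B ε))
        (trans (cong (ℚ._* ε) (ℚ.*-inverseʳ B {{ℚ.pos⇒nonZero B {{B>0}}}}))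
          (ℚ.*-identityˡ ε))
    where
    1/B : ℚ
    1/B = (ℚ.1/ B) {{ℚ.pos⇒nonZero B {{B>0}}}}

  *-close : ∀ A B α β ε .{{_ : ℚ.Positive A}} .{{_ : ℚ.Positive B}} →
            A ℚ.* α ≡ ½ ℚ.* ε → B ℚ.* β ≡ ½ ℚ.* ε → ∀ p q s t →
            ∣ p ∣ ℚ.≤ A → ∣ t ∣ ℚ.≤ B → ∣ q ℚ.- t ∣ ℚ.< α → ∣ p ℚ.- s ∣ ℚ.< β →
            ∣ p ℚ.* q ℚ.- s ℚ.* t ∣ ℚ.< ε
  *-close A B α β ε Aα Bβ p q s t p≤A t≤B q-t p-s = begin-strict
    ∣ p ℚ.* q ℚ.- s ℚ.* t ∣
      ≡⟨ cong ∣_∣ (*-sub p q s t) ⟩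
    ∣ p ℚ.* (q ℚ.- t) ℚ.+ t ℚ.* (p ℚ.- s) ∣
      ≤⟨ ℚ.∣p+q∣≤∣p∣+∣q∣ (p ℚ.* (q ℚ.- t)) (t ℚ.* (p ℚ.- s)) ⟩
    ∣ p ℚ.* (q ℚ.- t) ∣ ℚ.+ ∣ t ℚ.* (p ℚ.- s) ∣
      ≡⟨ cong₂ ℚ._+_ (ℚ.∣p*q∣≡∣p∣*∣q∣ p (q ℚ.- t)) (ℚ.∣p*q∣≡∣p∣*∣q∣ t (p ℚ.- s)) ⟩
    ∣ p ∣ ℚ.* ∣ q ℚ.- t ∣ ℚ.+ ∣ t ∣ ℚ.* ∣ p ℚ.- s ∣
      ≤⟨ ℚ.+-mono-≤
           (ℚ.*-monoʳ-≤-nonNeg ∣ q ℚ.- t ∣ {{ℚ.∣-∣-nonNeg (q ℚ.- t)}} p≤A)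
           (ℚ.*-monoʳ-≤-nonNeg ∣ p ℚ.- s ∣ {{ℚ.∣-∣-nonNeg (p ℚ.- s)}} t≤B) ⟩
    A ℚ.* ∣ q ℚ.- t ∣ ℚ.+ B ℚ.* ∣ p ℚ.- s ∣
      <⟨ ℚ.+-mono-< (ℚ.*-monoʳ-<-pos A q-t) (ℚ.*-monoʳ-<-pos B p-s) ⟩
    A ℚ.* α ℚ.+ B ℚ.* β       ≡⟨ cong₂ ℚ._+_ Aα Bβ ⟩
    ½ ℚ.* ε ℚ.+ ½ ℚ.* ε       ≡⟨ half+half ε ⟩
    ε                         ∎
    where open ℚ.≤-Reasoning

  *-cauchy : ∀ x y → Cauchy x → Cauchy y → Cauchy (λ n → x n ℚ.* y n)
  *-cauchy x y cx cy ε 0<ε =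
    let A , A>0 , a , hA = bounded x cx
        B , B>0 , b , hB = bounded y cy
        α , 0<α , Aα = shrink A (½ ℚ.* ε) A>0 (half-pos 0<ε)
        β , 0<β , Bβ = shrink B (½ ℚ.* ε) B>0 (half-pos 0<ε)
        k , hx = cx β 0<β
        l , hy = cy α 0<α
    in (a ℕ.⊔ b) ℕ.⊔ (k ℕ.⊔ l) , λ m n hm hn →
      let ab≤ : ∀ {o} → (a ℕ.⊔ b) ℕ.⊔ (k ℕ.⊔ l) ℕ.≤ o → a ℕ.⊔ b ℕ.≤ o
          ab≤ = ℕ.m⊔n≤o⇒m≤o (a ℕ.⊔ b) (k ℕ.⊔ l)
          kl≤ : ∀ {o} → (a ℕ.⊔ b) ℕ.⊔ (k ℕ.⊔ l) ℕ.≤ o → k ℕ.⊔ l ℕ.≤ o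
          kl≤ = ℕ.m⊔n≤o⇒n≤o (a ℕ.⊔ b) (k ℕ.⊔ l)
      in *-close A B α β ε {{A>0}} {{B>0}} Aα Bβ (x m) (y m) (x n) (y n)
           (hA m (ℕ.m⊔n≤o⇒m≤o a b (ab≤ hm)))
           (hB n (ℕ.m⊔n≤o⇒n≤o a b (ab≤ hn)))
           (hy m n (ℕ.m⊔n≤o⇒n≤o k l (kl≤ hm)) (ℕ.m⊔n≤o⇒n≤o k l (kl≤ hn)))
           (hx m n (ℕ.m⊔n≤o⇒m≤o k l (kl≤ hm)) (ℕ.m⊔n≤o⇒m≤o k l (kl≤ hn)))

fromℚ : ℚ → ℝ
fromℚ q = mkℝ (λ _ → q) λ ε 0<ε →
  0 , λ _ _ _ _ → subst (ℚ._< ε) (cong ∣_∣ (sym (ℚ.+-inverseʳ q))) 0<ε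

ℝ-rawRing : RawRing 0ℓ 0ℓ
ℝ-rawRing = record
  { Carrier = ℝ
  ; _≈_     = _≈ᴿ_
  ; _+_     = λ x y → mkℝ (λ n → approx x n ℚ.+ approx y n)
                          (CauchyLemmas.+-cauchy (approx x) (approx y) (cauchy x) (cauchy y))
  ; _*_     = λ x y → mkℝ (λ n → approx x n ℚ.* approx y n)
                          (CauchyLemmas.*-cauchy (approx x) (approx y) (cauchy x) (cauchy y))
  ; -_      = λ x → mkℝ (λ n → ℚ.- approx x n) (CauchyLemmas.neg-cauchy (approx x) (cauchy x))
  ; 0#      = fromℚ 0ℚ
  ; 1#      = fromℚ 1ℚ
  }

module ℝ⟦X⟧ = RawRing (powerSeries ℝ-rawRing)

ℝ⟦X⟧ : Set
ℝ⟦X⟧ = ℝ⟦X⟧.Carrier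

ι : ℚ⟦X⟧ → ℝ⟦X⟧
ι f n = fromℚ (f n)

-- ∫₀ˣ f(t) dt
∫ : ℝ⟦X⟧ → ℝ⟦X⟧
∫ f zero    = fromℚ 0ℚ
∫ f (suc n) = f n *ᴿ fromℚ (ℤ.+ 1 ℚ./ suc n)
  where open RawRing ℝ-rawRing renaming (_*_ to _*ᴿ_)

E : ∀ {k} → Word k k → ℝ⟦X⟧
E p = ι λ n → (ℤ.+ N p n) ℚ./ 1 ℚ.* 1/ n !

------------------------------------------------------------------------
-- The exponential of a power series, ∑ₘ fᵐ/m!, converging coefficientwise
-- for every f, also when its constant term is not zero

exp-partial : ℚ⟦X⟧ → ℕ → ℕ → ℚ
exp-partial f n k = ∑ ℚ.+-*-rawRing k (λ m → (f ℚ⟦X⟧.^ m) n ℚ.* 1/ m !)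

module ExpLemmas where
  open CauchyLemmas

  ∑ℚ : ℕ → (ℕ → ℚ) → ℚ
  ∑ℚ = ∑ ℚ.+-*-rawRing

  ∑-last : ∀ n a → ∑ℚ (suc n) a ≡ ∑ℚ n a ℚ.+ a n
  ∑-last zero    a = trans (ℚ.+-identityʳ (a 0)) (sym (ℚ.+-identityˡ (a 0)))
  ∑-last (suc n) a = trans (cong (a 0 ℚ.+_) (∑-last n (a ∘ suc)))
    (sym (ℚ.+-assoc (a 0) (∑ℚ n (a ∘ suc)) (a (suc n))))

  ∑-mono : ∀ {m n} → m ℕ.≤ n → ∀ a → (∀ i → 0ℚ ℚ.≤ a i) → ∑ℚ m a ℚ.≤ ∑ℚ n a
  ∑-mono {n = zero}  z≤n       a 0≤a = ℚ.≤-refl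
  ∑-mono {n = suc n} z≤n       a 0≤a = subst (ℚ._≤ ∑ℚ (suc n) a) (ℚ.+-identityˡ 0ℚ)
    (ℚ.+-mono-≤ (0≤a 0) (∑-mono {n = n} z≤n (a ∘ suc) (0≤a ∘ suc)))
  ∑-mono (s≤s m≤n) a 0≤a = ℚ.+-monoʳ-≤ (a 0) (∑-mono m≤n (a ∘ suc) (0≤a ∘ suc))

  ∣∑∣-≤ : ∀ n (a b : ℕ → ℚ) P → (∀ i → ∣ b i ∣ ℚ.≤ P) →
          ∣ ∑ℚ n (λ i → a i ℚ.* b i) ∣ ℚ.≤ ∑ℚ n (λ i → ∣ a i ∣) ℚ.* P
  ∣∑∣-≤ zero    a b P hb = ℚ.≤-reflexive (sym (ℚ.*-zeroˡ P))
  ∣∑∣-≤ (suc n) a b P hb = begin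
    ∣ a 0 ℚ.* b 0 ℚ.+ r ∣            ≤⟨ ℚ.∣p+q∣≤∣p∣+∣q∣ (a 0 ℚ.* b 0) r ⟩
    ∣ a 0 ℚ.* b 0 ∣ ℚ.+ ∣ r ∣        ≡⟨ cong (ℚ._+ ∣ r ∣) (ℚ.∣p*q∣≡∣p∣*∣q∣ (a 0) (b 0)) ⟩
    ∣ a 0 ∣ ℚ.* ∣ b 0 ∣ ℚ.+ ∣ r ∣
      ≤⟨ ℚ.+-mono-≤ (ℚ.*-monoˡ-≤-nonNeg ∣ a 0 ∣ {{ℚ.∣-∣-nonNeg (a 0)}} (hb 0))
                    (∣∑∣-≤ n (a ∘ suc) (b ∘ suc) P (hb ∘ suc)) ⟩
    ∣ a 0 ∣ ℚ.* P ℚ.+ s ℚ.* P        ≡⟨ ℚ.*-distribʳ-+ P ∣ a 0 ∣ s ⟨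
    (∣ a 0 ∣ ℚ.+ s) ℚ.* P            ∎
    where
    open ℚ.≤-Reasoning
    r s : ℚ
    r = ∑ℚ n (λ i → a (suc i) ℚ.* b (suc i))
    s = ∑ℚ n (λ i → ∣ a (suc i) ∣)

  toℚᵘ-/ : ∀ a b → ℚ.toℚᵘ (ℤ.+ a ℚ./ suc b) ℚᵘ.≃ mkℚᵘ (ℤ.+ a) b
  toℚᵘ-/ a b = ℚ.toℚᵘ-fromℚᵘ (mkℚᵘ (ℤ.+ a) b)

  /-≤ : ∀ a b c d → a ℕ.* suc d ℕ.≤ c ℕ.* suc b → ℤ.+ a ℚ./ suc b ℚ.≤ ℤ.+ c ℚ./ suc d
  /-≤ a b c d h = ℚ.toℚᵘ-cancel-≤
    (ℚᵘ.≤-respˡ-≃ (ℚᵘ.≃-sym (toℚᵘ-/ a b)) (ℚᵘ.≤-respʳ-≃ (ℚᵘ.≃-sym (toℚᵘ-/ c d))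
      (ℚᵘ.*≤* (subst₂ ℤ._≤_ (ℤ.pos-* a (suc d)) (ℤ.pos-* c (suc b)) (ℤ.+≤+ h)))))

  /-* : ∀ a b c d → (ℤ.+ a ℚ./ suc b) ℚ.* (ℤ.+ c ℚ./ suc d) ≡
                    ℤ.+ (a ℕ.* c) ℚ./ (suc b ℕ.* suc d)
  /-* a b c d = ℚ.toℚᵘ-injective (ℚᵘ.≃-trans
    (ℚ.toℚᵘ-homo-* (ℤ.+ a ℚ./ suc b) (ℤ.+ c ℚ./ suc d))
    (ℚᵘ.≃-trans (ℚᵘ.*-cong (toℚᵘ-/ a b) (toℚᵘ-/ c d))
      (ℚᵘ.≃-trans (ℚᵘ.≃-reflexive (cong (λ i → mkℚᵘ i (d ℕ.+ b ℕ.* suc d)) (sym (ℤ.pos-* a c))))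
        (ℚᵘ.≃-sym (toℚᵘ-/ (a ℕ.* c) (d ℕ.+ b ℕ.* suc d))))))

  -- r C is the telescoping bound for the tails of the exponential series.
  r : ℕ → ℕ → ℚ
  r C m = ℤ.+ C ℚ./ suc m

  0≤r : ∀ C m → 0ℚ ℚ.≤ r C m
  0≤r C m = ℚ.nonNegative⁻¹ (r C m) {{ℚ.normalize-nonNeg C (suc m)}}

  r-step : ∀ C m →
    ℤ.+ C ℚ./ (suc m ℕ.* suc (suc m)) ℚ.+ r C (suc m) ≡ r C m
  r-step C m = ℚ.toℚᵘ-injective (ℚᵘ.≃-trans
    (ℚ.toℚᵘ-homo-+ (ℤ.+ C ℚ./ (suc m ℕ.* suc (suc m))) (r C (suc m)))
    (ℚᵘ.≃-trans (ℚᵘ.+-cong (toℚᵘ-/ C (suc m ℕ.+ m ℕ.* suc (suc m))) (toℚᵘ-/ C (suc m)))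
      (ℚᵘ.≃-trans (ℚᵘ.*≡* eq) (ℚᵘ.≃-sym (toℚᵘ-/ C m)))))
    where
    p q : ℕ
    p = suc m
    q = suc (suc m)
    eqℕ : ∀ C m → (C ℕ.* suc (suc m) ℕ.+ C ℕ.* (suc m ℕ.* suc (suc m))) ℕ.* suc m ≡
                  C ℕ.* ((suc m ℕ.* suc (suc m)) ℕ.* suc (suc m))
    eqℕ = ℕ-Solver.solve-∀
    eq : (ℤ.+ C ℤ.* ℤ.+ q ℤ.+ ℤ.+ C ℤ.* ℤ.+ (p ℕ.* q)) ℤ.* ℤ.+ p ≡
         ℤ.+ C ℤ.* ℤ.+ ((p ℕ.* q) ℕ.* q)
    eq = trans (cong (ℤ._* ℤ.+ p) (cong₂ ℤ._+_ (sym (ℤ.pos-* C q)) (sym (ℤ.pos-* C (p ℕ.* q)))))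
      (trans (sym (ℤ.pos-* (C ℕ.* q ℕ.+ C ℕ.* (p ℕ.* q)) p))
        (trans (cong ℤ.+_ (eqℕ C m)) (ℤ.pos-* C ((p ℕ.* q) ℕ.* q))))

  r→0 : ∀ C ε → 0ℚ ℚ.< ε → ∃ λ m → r C m ℚ.< ε
  r→0 C ε@(ℚ.mkℚ (ℤ.+ zero) d _) 0<ε with ℚ.drop-*<* 0<ε
  ... | ℤ.+<+ ()
  r→0 C ε@(ℚ.mkℚ ℤ.-[1+ _ ] d _) 0<ε with ℚ.drop-*<* 0<ε
  ... | ()
  r→0 C ε@(ℚ.mkℚ (ℤ.+ suc p) d _) 0<ε = C ℕ.* suc d , ℚ.toℚᵘ-cancel-<
    (ℚᵘ.<-respˡ-≃ (ℚᵘ.≃-sym (toℚᵘ-/ C (C ℕ.* suc d))) (ℚᵘ.*<* lt))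
    where
    lt : ℤ.+ C ℤ.* ℤ.+ suc d ℤ.< ℤ.+ suc p ℤ.* ℤ.+ suc (C ℕ.* suc d)
    lt = subst (ℤ._< ℤ.+ suc p ℤ.* ℤ.+ suc (C ℕ.* suc d)) (ℤ.pos-* C (suc d))
           (ℤ.+<+ (ℕ.m≤m+n (suc (C ℕ.* suc d)) (p ℕ.* suc (C ℕ.* suc d))))

  telescoping⇒cauchy : ∀ x C → (∀ m → ∣ x (suc m) ℚ.- x m ∣ ℚ.+ r C (suc m) ℚ.≤ r C m) → Cauchy x
  telescoping⇒cauchy x C h ε 0<ε with r→0 C (½ ℚ.* ε) (half-pos 0<ε)
  ... | k , rk<ε = k , λ m n km kn → begin-strict
      ∣ x m ℚ.- x n ∣
        ≡⟨ cong ∣_∣ (sub-sub (x m) (x n) (x k)) ⟩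
      ∣ (x m ℚ.- x k) ℚ.+ (x k ℚ.- x n) ∣
        ≤⟨ ℚ.∣p+q∣≤∣p∣+∣q∣ (x m ℚ.- x k) (x k ℚ.- x n) ⟩
      ∣ x m ℚ.- x k ∣ ℚ.+ ∣ x k ℚ.- x n ∣
        ≡⟨ cong (∣ x m ℚ.- x k ∣ ℚ.+_) (∣-∣-comm (x k) (x n)) ⟩
      ∣ x m ℚ.- x k ∣ ℚ.+ ∣ x n ℚ.- x k ∣
        <⟨ ℚ.+-mono-< (near m km) (near n kn) ⟩
      ½ ℚ.* ε ℚ.+ ½ ℚ.* ε ≡⟨ half+half ε ⟩
      ε ∎
    where
    open ℚ.≤-Reasoning

    steps : ∀ d → ∣ x (d ℕ.+ k) ℚ.- x k ∣ ℚ.+ r C (d ℕ.+ k) ℚ.≤ r C k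
    steps zero = ℚ.≤-reflexive
      (trans (cong (λ z → ∣ z ∣ ℚ.+ r C k) (ℚ.+-inverseʳ (x k))) (ℚ.+-identityˡ (r C k)))
    steps (suc d) = let y = x (suc d ℕ.+ k); z = x (d ℕ.+ k) in begin
      ∣ y ℚ.- x k ∣ ℚ.+ r C (suc d ℕ.+ k)
        ≡⟨ cong (λ w → ∣ w ∣ ℚ.+ r C (suc d ℕ.+ k)) (sub-sub′ y (x k) z) ⟩
      ∣ (z ℚ.- x k) ℚ.+ (y ℚ.- z) ∣ ℚ.+ r C (suc d ℕ.+ k)
        ≤⟨ ℚ.+-monoˡ-≤ (r C (suc d ℕ.+ k)) (ℚ.∣p+q∣≤∣p∣+∣q∣ (z ℚ.- x k) (y ℚ.- z)) ⟩
      ∣ z ℚ.- x k ∣ ℚ.+ ∣ y ℚ.- z ∣ ℚ.+ r C (suc d ℕ.+ k)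
        ≡⟨ ℚ.+-assoc ∣ z ℚ.- x k ∣ ∣ y ℚ.- z ∣ (r C (suc d ℕ.+ k)) ⟩
      ∣ z ℚ.- x k ∣ ℚ.+ (∣ y ℚ.- z ∣ ℚ.+ r C (suc d ℕ.+ k))
        ≤⟨ ℚ.+-monoʳ-≤ ∣ z ℚ.- x k ∣ (h (d ℕ.+ k)) ⟩
      ∣ z ℚ.- x k ∣ ℚ.+ r C (d ℕ.+ k) ≤⟨ steps d ⟩
      r C k ∎

    near : ∀ m → k ℕ.≤ m → ∣ x m ℚ.- x k ∣ ℚ.< ½ ℚ.* ε
    near m km = begin-strict
      ∣ x m ℚ.- x k ∣                    ≡⟨ ℚ.+-identityʳ ∣ x m ℚ.- x k ∣ ⟨
      ∣ x m ℚ.- x k ∣ ℚ.+ 0ℚ             ≤⟨ ℚ.+-monoʳ-≤ ∣ x m ℚ.- x k ∣ (0≤r C m) ⟩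
      ∣ x m ℚ.- x k ∣ ℚ.+ r C m
        ≤⟨ subst (λ j → ∣ x j ℚ.- x k ∣ ℚ.+ r C j ℚ.≤ r C k) (ℕ.m∸n+n≡m km) (steps (m ℕ.∸ k)) ⟩
      r C k                              <⟨ rk<ε ⟩
      ½ ℚ.* ε ∎

  ⌈∣_∣⌉ : ℚ → ℕ
  ⌈∣ q ∣⌉ = suc ℤ.∣ ℚ.↥ q ∣

  ≤⌈∣∣⌉ : ∀ q → 0ℚ ℚ.≤ q → q ℚ.≤ ℤ.+ ⌈∣ q ∣⌉ ℚ./ 1
  ≤⌈∣∣⌉ (ℚ.mkℚ ℤ.-[1+ _ ] d c) 0≤q with ℚ.drop-*≤* 0≤q
  ... | ()
  ≤⌈∣∣⌉ q@(ℚ.mkℚ (ℤ.+ n) d c) 0≤q =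
    subst (ℚ._≤ ℤ.+ suc n ℚ./ 1) (ℚ.↥p/↧p≡p q)
      (/-≤ n d (suc n) 0 (ℕ.*-mono-≤ (ℕ.n≤1+n n) (s≤s z≤n)))

  ^-bound : ∀ f n K → ∑ℚ (suc n) (λ i → ∣ f i ∣) ℚ.≤ ℤ.+ K ℚ./ 1 →
            ∀ m j → j ℕ.≤ n → ∣ (f ℚ⟦X⟧.^ m) j ∣ ℚ.≤ ℤ.+ (K ℕ.^ m) ℚ./ 1
  ^-bound f n K hK zero    zero    j≤n = ℚ.≤-refl
  ^-bound f n K hK zero    (suc j) j≤n = ℚ.nonNegative⁻¹ 1ℚ
  ^-bound f n K hK (suc m) j       j≤n = begin
    ∣ ∑ℚ (suc j) (λ i → f i ℚ.* (f ℚ⟦X⟧.^ m) (j ℕ.∸ i)) ∣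
      ≤⟨ ∣∑∣-≤ (suc j) f (λ i → (f ℚ⟦X⟧.^ m) (j ℕ.∸ i)) P
           (λ i → ^-bound f n K hK m (j ℕ.∸ i) (ℕ.≤-trans (ℕ.m∸n≤m j i) j≤n)) ⟩
    ∑ℚ (suc j) (λ i → ∣ f i ∣) ℚ.* P
      ≤⟨ ℚ.*-monoʳ-≤-nonNeg P {{ℚ.normalize-nonNeg (K ℕ.^ m) 1}}
           (ℚ.≤-trans (∑-mono (s≤s j≤n) (λ i → ∣ f i ∣) (λ i → ℚ.0≤∣p∣ (f i))) hK) ⟩
    (ℤ.+ K ℚ./ 1) ℚ.* P              ≡⟨ /-* K 0 (K ℕ.^ m) 0 ⟩
    ℤ.+ (K ℕ.^ suc m) ℚ./ 1          ∎
    where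
    open ℚ.≤-Reasoning
    P : ℚ
    P = ℤ.+ (K ℕ.^ m) ℚ./ 1

  ^≤^*! : ∀ L .{{_ : ℕ.NonZero L}} m → L ℕ.^ m ℕ.≤ L ℕ.^ L ℕ.* m !
  ^≤^*! L zero    = subst (1 ℕ.≤_) (sym (ℕ.*-identityʳ (L ℕ.^ L))) (ℕ.m^n>0 L L)
  ^≤^*! L (suc m) with suc m ℕ.≤? L
  ... | yes m<L = ℕ.≤-trans (ℕ.^-monoʳ-≤ L m<L)
                    (ℕ.m≤m*n (L ℕ.^ L) (suc m !) {{suc m ℕ.!≢0}})
  ... | no  m≮L = begin
    L ℕ.* L ℕ.^ m                    ≤⟨ ℕ.*-mono-≤ (ℕ.<⇒≤ (ℕ.≰⇒> m≮L)) (^≤^*! L m) ⟩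
    suc m ℕ.* (L ℕ.^ L ℕ.* m !)      ≡⟨ lemma (suc m) (L ℕ.^ L) (m !) ⟩
    L ℕ.^ L ℕ.* (suc m ℕ.* m !)      ∎
    where
    open ℕ.≤-Reasoning
    lemma : ∀ a b c → a ℕ.* (b ℕ.* c) ≡ b ℕ.* (a ℕ.* c)
    lemma = ℕ-Solver.solve-∀

  quadratic≤exponential : ∀ m → suc m ℕ.* suc (suc m) ℕ.≤ 2 ℕ.* 4 ℕ.^ m
  quadratic≤exponential zero    = ℕ.≤-refl
  quadratic≤exponential (suc m) = begin
    suc (suc m) ℕ.* suc (suc (suc m))    ≤⟨ ℕ.m≤m+n _ (suc (suc m) ℕ.* (1 ℕ.+ 3 ℕ.* m)) ⟩
    suc (suc m) ℕ.* suc (suc (suc m)) ℕ.+ suc (suc m) ℕ.* (1 ℕ.+ 3 ℕ.* m) ≡⟨ lemma m ⟩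
    4 ℕ.* (suc m ℕ.* suc (suc m))        ≤⟨ ℕ.*-monoʳ-≤ 4 (quadratic≤exponential m) ⟩
    4 ℕ.* (2 ℕ.* 4 ℕ.^ m)                ≡⟨ lemma′ (4 ℕ.^ m) ⟩
    2 ℕ.* (4 ℕ.* 4 ℕ.^ m)                ∎
    where
    open ℕ.≤-Reasoning
    lemma : ∀ m → suc (suc m) ℕ.* suc (suc (suc m)) ℕ.+ suc (suc m) ℕ.* (1 ℕ.+ 3 ℕ.* m)
                  ≡ 4 ℕ.* (suc m ℕ.* suc (suc m))
    lemma = ℕ-Solver.solve-∀
    lemma′ : ∀ a → 4 ℕ.* (2 ℕ.* a) ≡ 2 ℕ.* (4 ℕ.* a)
    lemma′ = ℕ-Solver.solve-∀

  exp-cauchy : ∀ f n → Cauchy (exp-partial f n)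
  exp-cauchy f n = telescoping⇒cauchy (exp-partial f n) C step
    where
    open ℚ.≤-Reasoning
    S : ℚ
    S = ∑ℚ (suc n) (λ i → ∣ f i ∣)
    K L C : ℕ
    K = ⌈∣ S ∣⌉
    L = K ℕ.* 4
    C = 2 ℕ.* L ℕ.^ L

    S≤K : S ℚ.≤ ℤ.+ K ℚ./ 1
    S≤K = ≤⌈∣∣⌉ S (∑-mono {0} {suc n} z≤n (λ i → ∣ f i ∣) (λ i → ℚ.0≤∣p∣ (f i)))

    a : ℕ → ℚ
    a m = (f ℚ⟦X⟧.^ m) n ℚ.* 1/ m !

    ^-distrib-* : ∀ m → K ℕ.^ m ℕ.* 4 ℕ.^ m ≡ L ℕ.^ m
    ^-distrib-* zero    = refl
    ^-distrib-* (suc m) = trans (lemma K 4 (K ℕ.^ m) (4 ℕ.^ m))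
      (cong (L ℕ.*_) (^-distrib-* m))
      where
      lemma : ∀ a b c d → (a ℕ.* c) ℕ.* (b ℕ.* d) ≡ (a ℕ.* b) ℕ.* (c ℕ.* d)
      lemma = ℕ-Solver.solve-∀

    K^m-bound : ∀ m → K ℕ.^ m ℕ.* (suc m ℕ.* suc (suc m)) ℕ.≤ C ℕ.* m !
    K^m-bound m = ℕR.begin
      K ℕ.^ m ℕ.* (suc m ℕ.* suc (suc m)) ℕR.≤⟨ ℕ.*-monoʳ-≤ (K ℕ.^ m) (quadratic≤exponential m) ⟩
      K ℕ.^ m ℕ.* (2 ℕ.* 4 ℕ.^ m)         ℕR.≡⟨ lemma (K ℕ.^ m) (4 ℕ.^ m) ⟩
      2 ℕ.* (K ℕ.^ m ℕ.* 4 ℕ.^ m)         ℕR.≡⟨ cong (2 ℕ.*_) (^-distrib-* m) ⟩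
      2 ℕ.* L ℕ.^ m                       ℕR.≤⟨ ℕ.*-monoʳ-≤ 2 (^≤^*! L m) ⟩
      2 ℕ.* (L ℕ.^ L ℕ.* m !)             ℕR.≡⟨ sym (ℕ.*-assoc 2 (L ℕ.^ L) (m !)) ⟩
      C ℕ.* m !                           ℕR.∎
      where
      module ℕR = ℕ.≤-Reasoning
      lemma : ∀ a b → a ℕ.* (2 ℕ.* b) ≡ 2 ℕ.* (a ℕ.* b)
      lemma = ℕ-Solver.solve-∀

    frac : ∀ k q d .{{_ : ℕ.NonZero d}} → k ℕ.* (suc q) ℕ.≤ C ℕ.* d →
           (ℤ.+ k ℚ./ 1) ℚ.* (ℤ.+ 1 ℚ./ d) ℚ.≤ ℤ.+ C ℚ./ suc q
    frac k q (suc d) h = begin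
      (ℤ.+ k ℚ./ 1) ℚ.* (ℤ.+ 1 ℚ./ suc d)  ≡⟨ /-* k 0 1 d ⟩
      ℤ.+ (k ℕ.* 1) ℚ./ (1 ℕ.* suc d)
        ≤⟨ /-≤ (k ℕ.* 1) (d ℕ.+ 0) C q
             (subst₂ (λ i j → i ℕ.* suc q ℕ.≤ C ℕ.* suc j)
               (sym (ℕ.*-identityʳ k)) (sym (ℕ.+-identityʳ d)) h) ⟩
      ℤ.+ C ℚ./ suc q                      ∎

    ∣a∣≤ : ∀ m → ∣ a m ∣ ℚ.≤ ℤ.+ C ℚ./ (suc m ℕ.* suc (suc m))
    ∣a∣≤ m = begin
      ∣ (f ℚ⟦X⟧.^ m) n ℚ.* 1/ m ! ∣        ≡⟨ ℚ.∣p*q∣≡∣p∣*∣q∣ ((f ℚ⟦X⟧.^ m) n) (1/ m !) ⟩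
      ∣ (f ℚ⟦X⟧.^ m) n ∣ ℚ.* ∣ 1/ m ! ∣
        ≡⟨ cong (∣ (f ℚ⟦X⟧.^ m) n ∣ ℚ.*_) (ℚ.0≤p⇒∣p∣≡p (ℚ.nonNegative⁻¹ (1/ m !) {{1/!≥0}})) ⟩
      ∣ (f ℚ⟦X⟧.^ m) n ∣ ℚ.* 1/ m !
        ≤⟨ ℚ.*-monoʳ-≤-nonNeg (1/ m !) {{1/!≥0}} (^-bound f n K S≤K m n ℕ.≤-refl) ⟩
      (ℤ.+ (K ℕ.^ m) ℚ./ 1) ℚ.* 1/ m !
        ≤⟨ frac (K ℕ.^ m) (suc m ℕ.+ m ℕ.* suc (suc m)) (m !) {{m ℕ.!≢0}} (K^m-bound m) ⟩
      ℤ.+ C ℚ./ (suc m ℕ.* suc (suc m))    ∎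
      where
      1/!≥0 : ℚ.NonNegative (1/ m !)
      1/!≥0 = ℚ.normalize-nonNeg 1 (m !) {{m ℕ.!≢0}}

    step : ∀ m → ∣ exp-partial f n (suc m) ℚ.- exp-partial f n m ∣ ℚ.+ r C (suc m) ℚ.≤ r C m
    step m = begin
      ∣ exp-partial f n (suc m) ℚ.- exp-partial f n m ∣ ℚ.+ r C (suc m)
        ≡⟨ cong (λ z → ∣ z ℚ.- ∑ℚ m a ∣ ℚ.+ r C (suc m)) (∑-last m a) ⟩
      ∣ (∑ℚ m a ℚ.+ a m) ℚ.- ∑ℚ m a ∣ ℚ.+ r C (suc m)
        ≡⟨ cong (λ z → ∣ z ∣ ℚ.+ r C (suc m)) (add-sub (∑ℚ m a) (a m)) ⟩
      ∣ a m ∣ ℚ.+ r C (suc m)              ≤⟨ ℚ.+-monoˡ-≤ (r C (suc m)) (∣a∣≤ m) ⟩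
      ℤ.+ C ℚ./ (suc m ℕ.* suc (suc m)) ℚ.+ r C (suc m)  ≡⟨ r-step C m ⟩
      r C m                                ∎

exp : ℚ⟦X⟧ → ℝ⟦X⟧
exp f n = mkℝ (exp-partial f n) (ExpLemmas.exp-cauchy f n)

-- Read a word from right to left.  It avoids 3-12 iff every ascent top is a
-- left-to-right maximum, that is, exceeds every letter that is still to be read.
-- Hence the number of ways to complete a suffix depends only on the number u of
-- unused letters and on the number a of unused letters below the last letter read;
-- with a = u it satisfies the recurrence N(n+1) = ∑ᵢ (n choose i) N(i) + [n ≥ k-1]
-- (without the last term if k = 1).  So the generating function solves
-- y′ = eˣ y + ∑_{n≥k-1} xⁿ/n!, as does the right-hand side: differentiating the
-- partial sums of exp f gives (exp f)′ = f′ exp f, so exp eˣ · exp (-eˣ) has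
-- derivative 0, and its constant term e · e⁻¹ is 1 because the sums of the first n
-- terms of the two series have product 1 up to an error of at most 2 · 2ⁿ/n!.
{-# OPTIONS --safe #-}
module Submission where

open import Algebra.Bundles using (CommutativeRing)
open import Algebra.Bundles.Raw using (RawRing)
open import Algebra.Properties.CommutativeSemigroup using (interchange)
import Algebra.Properties.Ring as RingProperties
import Algebra.Properties.Semiring.Sum as SemiringSum
import Algebra.Solver.Ring.NaturalCoefficients.Default as RingSolver
open import Data.Bool.Base using (Bool; true; false; T; if_then_else_; not; _∧_; _∨_)
open import Data.Bool.Properties using (T-∧; T-∨; T-≡; T?; ∨-zeroʳ; ∨-identityʳ; ∧-zeroʳ)
open import Data.Fin.Base as Fin using (Fin; zero; suc; toℕ; opposite; inject≤)
import Data.Fin.Properties as Fin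
import Data.Integer.Base as ℤ
import Data.Integer.Properties as ℤ
open import Data.List.Base as List using (List; allFin; cartesianProductWith; filter; length)
import Data.List.Properties as List
open import Data.Nat.Base as ℕ using (ℕ; zero; suc; _!; z≤n; s≤s; _≤_; _∸_)
open import Data.Nat.Induction using (<-rec)
import Data.Nat.Properties as ℕ
open import Data.Product.Base using (∃; _×_; _,_)
open import Data.Rational.Base as ℚ using (ℚ; 0ℚ; 1ℚ; ½; ∣_∣)
import Data.Rational.Properties as ℚ
open import Data.Rational.Solver using (module +-*-Solver)
import Data.Rational.Unnormalised.Base as ℚᵘ
import Data.Rational.Unnormalised.Properties as ℚᵘ
open import Data.Sum.Base using (_⊎_; inj₁; inj₂)
open import Data.Unit.Base using (⊤; tt)
open import Data.Vec.Base using ([]; _∷_; lookup; tabulate)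
import Data.Vec.Properties as Vec
open import Data.Vec.Relation.Unary.All using ([]; _∷_)
import Data.Vec.Relation.Unary.All.Properties as All
open import Data.Vec.Relation.Unary.AllPairs using ([]; _∷_)
open import Data.Vec.Relation.Unary.Unique.Propositional using (Unique)
open import Data.Vec.Relation.Unary.Unique.Propositional.Properties using (lookup-injective)
open import Defs
open import Function.Base using (_∘_; const; id)
open import Function.Bundles using (_⇔_; mk⇔; module Equivalence)
open import Level using (0ℓ)
open import Relation.Binary.Definitions using (tri<; tri≈; tri>)
import Relation.Binary.PropositionalEquality as ≡
open ≡ using (_≡_)
open import Relation.Nullary using (yes; no; ¬_; does; contradiction)
open import Relation.Nullary.Decidable using (does-⇔; dec-false)
open import Relation.Unary using (Decidable)
open CauchyLemmas
open ExpLemmas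

-- Write F(u,a) for `extensions`. Splitting off i = a gives F(u+1,a) = F(u,a) + F(u+1,a+1) for a <
-- u, and F(u+1,u) = F(u,u): Pascal's rule, with the diagonal values F(t,t) as boundary data. The
-- diagonal feeds on itself because F(n+1,n+1) = F(n+1,0) as soon as k ≤ n+1. Now F(0,0) = 1,
-- whereas for k ≥ 2 the empty permutation does not begin with the pattern; this mismatch is the
-- source of the summand [n ≥ k-1]. On the analytic side no limit is exchanged with a derivative:
-- the derivative of the partial sum of exp f with m+1 terms is exactly f′ times the one with m
-- terms, and a real number is unaffected by the shift. Differentiation cannot supply the constant
-- term of exp eˣ · exp (-eˣ), a product of two limits. For it the partial sums for e and e⁻¹ are
-- read as the coefficients of eˣ/(1-x) and e⁻ˣ/(1-x), so that the formal identity eˣ · e⁻ˣ = 1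
-- becomes available.

-- ∑ᵢ (n choose i) aᵢ, computed by Pascal's rule.
binomial-sum : ℕ → (ℕ → ℕ) → ℕ
binomial-sum zero    a = a 0
binomial-sum (suc n) a = binomial-sum n a ℕ.+ binomial-sum n (a ∘ suc)

indicator-from : ℕ → ℕ → ℕ
indicator-from m n = if m ℕ.≤ᵇ n then 1 else 0

-- Counting permutations

module Counting where
  open import Data.Nat.Base using (_+_; _≤ᵇ_; _<_)
  open import Data.Nat.ListAction using (sum)
  open import Data.Nat.ListAction.Properties using (sum-++)
  open ≡ using (refl; sym; trans; cong; cong₂; subst; subst₂; _≗_; _≢_)

  total : ∀ {A : Set} → (A → ℕ) → List A → ℕ
  total f xs = sum (List.map f xs)

  module _ {A : Set} where
    total-cong : ∀ {f g : A → ℕ} → f ≗ g → ∀ xs → total f xs ≡ total g xs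
    total-cong f≗g xs = cong sum (List.map-cong f≗g xs)

    total-zero : ∀ (xs : List A) → total (const 0) xs ≡ 0
    total-zero List.[]       = refl
    total-zero (x List.∷ xs) = total-zero xs

    total-+ : ∀ (f g : A → ℕ) xs → total (λ x → f x + g x) xs ≡ total f xs + total g xs
    total-+ f g List.[]       = refl
    total-+ f g (x List.∷ xs) = trans (cong (f x + g x +_) (total-+ f g xs))
      (interchange ℕ.+-commutativeSemigroup (f x) (g x) (total f xs) (total g xs))

    -- Replaces the decision procedures inside `N` by a Boolean test that recurses on the word.
    length-filter : ∀ {P : A → Set} (P? : Decidable P) (b : A → Bool) → (∀ x → P x ⇔ T (b x)) →
                    ∀ xs → length (filter P? xs) ≡ total (λ x → if b x then 1 else 0) xs
    length-filter P? b P⇔b List.[]       = refl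
    length-filter P? b P⇔b (x List.∷ xs) with does (P? x) | b x | does-⇔ (P⇔b x) (P? x) (T? (b x))
    ... | true  | .true  | refl = cong suc (length-filter P? b P⇔b xs)
    ... | false | .false | refl = length-filter P? b P⇔b xs

  -- The order of summation is exchanged: `words` runs through the first letter outermost, whereas
  -- the count fixes a suffix and sums over the letter in front of it.
  total-cartesianProductWith : ∀ {A B C : Set} (f : C → ℕ) (g : A → B → C) xs ys →
    total f (cartesianProductWith g xs ys) ≡ total (λ y → total (λ x → f (g x y)) xs) ys
  total-cartesianProductWith f g List.[]       ys = sym (total-zero ys)
  total-cartesianProductWith f g (x List.∷ xs) ys = begin
    sum (List.map f (List.map (g x) ys List.++ cartesianProductWith g xs ys))
      ≡⟨ cong sum (List.map-++ f (List.map (g x) ys) (cartesianProductWith g xs ys)) ⟩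
    sum (List.map f (List.map (g x) ys) List.++ List.map f (cartesianProductWith g xs ys))
      ≡⟨ sum-++ (List.map f (List.map (g x) ys)) (List.map f (cartesianProductWith g xs ys)) ⟩
    sum (List.map f (List.map (g x) ys)) + total f (cartesianProductWith g xs ys)
      ≡⟨ cong₂ _+_ (cong sum (sym (List.map-∘ ys))) (total-cartesianProductWith f g xs ys) ⟩
    total (λ y → f (g x y)) ys + total (λ y → total (λ x → f (g x y)) xs) ys
      ≡⟨ total-+ (λ y → f (g x y)) (λ y → total (λ x → f (g x y)) xs) ys ⟨
    total (λ y → f (g x y) + total (λ x → f (g x y)) xs) ys ∎
    where open ≡.≡-Reasoning

  sumBelow : ℕ → (ℕ → ℕ) → ℕ
  sumBelow zero    g = 0
  sumBelow (suc n) g = g 0 + sumBelow n (g ∘ suc)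

  sumBelow-cong : ∀ n {f g} → (∀ i → i < n → f i ≡ g i) → sumBelow n f ≡ sumBelow n g
  sumBelow-cong zero    h = refl
  sumBelow-cong (suc n) h = cong₂ _+_ (h 0 (s≤s z≤n)) (sumBelow-cong n λ i i<n → h (suc i) (s≤s i<n))

  sumBelow-zero : ∀ n {f} → (∀ i → i < n → f i ≡ 0) → sumBelow n f ≡ 0
  sumBelow-zero zero    h = refl
  sumBelow-zero (suc n) h = cong₂ _+_ (h 0 (s≤s z≤n)) (sumBelow-zero n λ i i<n → h (suc i) (s≤s i<n))

  bit : Bool → ℕ
  bit b = if b then 1 else 0

  -- The number of elements of U that are smaller than t.
  below : ∀ {n} → (Fin n → Bool) → ℕ → ℕ
  below {zero}  U t       = 0
  below {suc n} U zero    = 0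
  below {suc n} U (suc t) = bit (U zero) + below (U ∘ suc) t

  below-cong : ∀ {n} {U V : Fin n → Bool} → U ≗ V → ∀ t → below U t ≡ below V t
  below-cong {zero}  p t       = refl
  below-cong {suc n} p zero    = refl
  below-cong {suc n} p (suc t) = cong₂ _+_ (cong bit (p zero)) (below-cong (p ∘ suc) t)

  below-all : ∀ n → below {n} (const true) n ≡ n
  below-all zero    = refl
  below-all (suc n) = cong suc (below-all n)

  below-mono : ∀ {n} (U : Fin n → Bool) {s t} → s ≤ t → below U s ≤ below U t
  below-mono {zero}  U _         = z≤n
  below-mono {suc n} U z≤n       = z≤n
  below-mono {suc n} U (s≤s s≤t) = ℕ.+-monoʳ-≤ (bit (U zero)) (below-mono (U ∘ suc) s≤t)

  below-suc : ∀ {n} (U : Fin n → Bool) c → U c ≡ true → below U (suc (toℕ c)) ≡ suc (below U (toℕ c))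
  below-suc {suc n} U zero    Uc = cong₂ _+_ (cong bit Uc) (below-0 (U ∘ suc))
    where
    below-0 : ∀ {n} (V : Fin n → Bool) → below V 0 ≡ 0
    below-0 {zero}  V = refl
    below-0 {suc n} V = refl
  below-suc {suc n} U (suc c) Uc =
    trans (cong (bit (U zero) +_) (below-suc (U ∘ suc) c Uc)) (ℕ.+-suc (bit (U zero)) _)

  below-≤⇔ : ∀ {n} (U : Fin n → Bool) c t → U c ≡ true → below U t ≤ below U (toℕ c) ⇔ t ≤ toℕ c
  below-≤⇔ U c t Uc = mk⇔ to (below-mono U)
    where
    to : below U t ≤ below U (toℕ c) → t ≤ toℕ c
    to h = ℕ.≮⇒≥ λ c<t → ℕ.<⇒≱ (subst (_≤ below U t) (below-suc U c Uc) (below-mono U c<t)) h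

  -- An element of `U` at or above `t` would be counted below `n` but not below `t`. This turns the
  -- second alternative of `extends` into a statement about letters.
  below-full⇔ : ∀ {n} (U : Fin n → Bool) t → below U n ≤ below U t ⇔ (∀ e → U e ≡ true → toℕ e < t)
  below-full⇔ {n} U t = mk⇔ to (from U t)
    where
    to : below U n ≤ below U t → ∀ e → U e ≡ true → toℕ e < t
    to h e Ue = ℕ.≰⇒> λ t≤e → ℕ.<⇒≱
      (subst (_≤ below U n) (below-suc U e Ue) (below-mono U (Fin.toℕ<n e)))
      (ℕ.≤-trans h (below-mono U t≤e))

    from : ∀ {n} (U : Fin n → Bool) t → (∀ e → U e ≡ true → toℕ e < t) → below U n ≤ below U t
    from {zero}  U t       h = z≤n
    from {suc n} U zero    h = subst (_≤ 0) (sym (trans (below-cong none (suc n)) (empty (suc n)))) z≤n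
      where
      none : U ≗ const false
      none e with U e in Ue
      ... | false = refl
      ... | true  = contradiction (h e Ue) λ ()
      empty : ∀ n → below {n} (const false) n ≡ 0
      empty zero    = refl
      empty (suc n) = empty n
    from {suc n} U (suc t) h = ℕ.+-monoʳ-≤ (bit (U zero)) (from (U ∘ suc) t λ e Ue → ℕ.s≤s⁻¹ (h (suc e) Ue))

  remove : ∀ {n} → (Fin n → Bool) → Fin n → Fin n → Bool
  remove U c e = U e ∧ not (does (e Fin.≟ c))

  remove-zero : ∀ {n} (U : Fin (suc n) → Bool) → remove U zero ∘ suc ≗ U ∘ suc
  remove-zero U e with U (suc e)
  ... | true  = refl
  ... | false = refl

  below-remove : ∀ {n} (U : Fin n → Bool) c → below (remove U c) (toℕ c) ≡ below U (toℕ c)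
  below-remove {suc n} U zero    = refl
  below-remove {suc n} U (suc c) = cong₂ _+_ (bit-∧-true (U zero)) (below-remove (U ∘ suc) c)
    where
    bit-∧-true : ∀ b → bit (b ∧ true) ≡ bit b
    bit-∧-true true  = refl
    bit-∧-true false = refl

  below-remove-full : ∀ {n} (U : Fin n → Bool) c → U c ≡ true → below U n ≡ suc (below (remove U c) n)
  below-remove-full {suc n} U zero    Uc rewrite Uc = cong suc (sym (below-cong (remove-zero U) n))
  below-remove-full {suc n} U (suc c) Uc with U zero
  ... | true  = cong suc (below-remove-full (U ∘ suc) c Uc)
  ... | false = below-remove-full (U ∘ suc) c Uc

  sum-by-rank : ∀ {n} (U : Fin n → Bool) (g : ℕ → ℕ) →
    sum (List.tabulate λ c → if U c then g (below U (toℕ c)) else 0) ≡ sumBelow (below U n) g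
  sum-by-rank {zero}  U g = refl
  sum-by-rank {suc n} U g with U zero
  ... | true  = cong (g 0 +_) (sum-by-rank (U ∘ suc) (g ∘ suc))
  ... | false = sum-by-rank (U ∘ suc) g

  -- Counting words from right to left

  -- The letter put in front of a suffix is the one that exceeds exactly i of the u unused
  -- letters, of which a are below the first letter of the suffix (a = u for the empty
  -- suffix).  Either it makes a descent or that first letter exceeds all unused ones; the
  -- latter is excluded if u < k, since the first k letters have to decrease.
  extends : ℕ → ℕ → ℕ → ℕ → Bool
  extends k u a i = (a ≤ᵇ i) ∨ ((k ≤ᵇ u) ∧ (u ≤ᵇ a))

  -- The number of ways to complete a suffix. Once the letter of rank `i` is used, `i` of the
  -- remaining `u` letters lie below it, which makes `i` the new last argument.
  extensions : ℕ → ℕ → ℕ → ℕ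
  extensions k zero    a = 1
  extensions k (suc u) a = sumBelow (suc u) λ i → if extends k (suc u) a i then extensions k u i else 0

  module _ (k n : ℕ) where
    unused : ∀ {m} → Word n m → Fin n → Bool
    unused []      = const true
    unused (c ∷ w) = remove (unused w) c

    -- The value `n` at the empty suffix acts as a letter above all others. The last letter of the
    -- permutation can then only pass the second alternative of `extends`, and this enforces
    -- `k ≤ n`.
    threshold : ∀ {m} → Word n m → ℕ
    threshold []      = n
    threshold (c ∷ w) = toℕ c

    valid : ∀ {m} → Word n m → Bool
    valid [] = true
    valid {suc m} (c ∷ w) = valid w ∧ (unused w c ∧
      extends k (n ∸ m) (below (unused w) (threshold w)) (below (unused w) (toℕ c)))

    -- Intended as the number of valid words of length `n` that end in `w`.
    weight : ∀ {m} → Word n m → ℕ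
    weight {m} w = if valid w then extensions k (n ∸ m) (below (unused w) (threshold w)) else 0

    unused-count : ∀ {m} (w : Word n m) → valid w ≡ true → below (unused w) n ≡ n ∸ m
    unused-count []      _ = below-all n
    unused-count {suc m} (c ∷ w) v with valid w in vw | unused w c in uc
    ... | true | true = trans (cong ℕ.pred (trans (sym (below-remove-full (unused w) c uc)) (unused-count w vw)))
      (ℕ.pred[m∸n]≡m∸[1+n] n m)

    weight-∷ : ∀ {m} → m < n → (w : Word n m) → sum (List.tabulate λ c → weight (c ∷ w)) ≡ weight w
    weight-∷ {m} m<n w with valid w in vw
    ... | false = sum-zero n
      where
      sum-zero : ∀ n → sum (List.tabulate {n = n} λ c → 0) ≡ 0
      sum-zero zero    = refl
      sum-zero (suc n) = sum-zero n
    ... | true  = begin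
      sum (List.tabulate λ c → if U c ∧ extends k (n ∸ m) a (below U (toℕ c))
                               then extensions k (n ∸ suc m) (below (remove U c) (toℕ c)) else 0)
        ≡⟨ cong sum (List.tabulate-cong term) ⟩
      sum (List.tabulate λ c → if U c then g (below U (toℕ c)) else 0)
        ≡⟨ sum-by-rank U g ⟩
      sumBelow (below U n) g
        ≡⟨ cong (λ u → sumBelow u g) (trans (unused-count w vw) n∸m) ⟩
      sumBelow (suc (n ∸ suc m)) g
        ≡⟨ cong (λ u → sumBelow (suc (n ∸ suc m)) λ i → if extends k u a i then extensions k (n ∸ suc m) i else 0) n∸m ⟩
      extensions k (suc (n ∸ suc m)) a
        ≡⟨ cong (λ u → extensions k u a) n∸m ⟨
      extensions k (n ∸ m) a ∎
      where
      open ≡.≡-Reasoning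
      U : Fin n → Bool
      U = unused w
      a : ℕ
      a = below U (threshold w)
      g : ℕ → ℕ
      g i = if extends k (n ∸ m) a i then extensions k (n ∸ suc m) i else 0
      n∸m : n ∸ m ≡ suc (n ∸ suc m)
      n∸m = ℕ.+-∸-assoc 1 m<n
      term : ∀ c → (if U c ∧ extends k (n ∸ m) a (below U (toℕ c))
                    then extensions k (n ∸ suc m) (below (remove U c) (toℕ c)) else 0)
                   ≡ (if U c then g (below U (toℕ c)) else 0)
      term c with U c
      ... | false = refl
      ... | true  = cong (λ i → if extends k (n ∸ m) a (below U (toℕ c)) then extensions k (n ∸ suc m) i else 0)
                      (below-remove U c)

    -- Putting a letter in front distributes the weight of a suffix over its extensions, so the
    -- total does not depend on the length `m`; for the empty word it is read off directly.
    total-weight : ∀ m → m ≤ n → total weight (words n m) ≡ extensions k n n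
    total-weight zero    _   = trans (ℕ.+-identityʳ _) (cong (extensions k n) (below-all n))
    total-weight (suc m) m<n = begin
      total weight (words n (suc m))
        ≡⟨ total-cartesianProductWith weight _∷_ (allFin n) (words n m) ⟩
      total (λ w → total (λ c → weight (c ∷ w)) (allFin n)) (words n m)
        ≡⟨ total-cong (λ w → trans (cong sum (List.map-tabulate {n = n} id (λ c → weight (c ∷ w)))) (weight-∷ m<n w)) (words n m) ⟩
      total weight (words n m)  ≡⟨ total-weight m (ℕ.<⇒≤ m<n) ⟩
      extensions k n n          ∎
      where open ≡.≡-Reasoning

    count-valid : total (λ w → if valid w then 1 else 0) (words n n) ≡ extensions k n n
    count-valid = trans (total-cong (λ w → cong (λ u → if valid w then u else 0) (full w)) (words n n))
      (total-weight n ℕ.≤-refl)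
      where
      full : ∀ (w : Word n n) → 1 ≡ extensions k (n ∸ n) (below (unused w) (threshold w))
      full w = cong (λ u → extensions k u (below (unused w) (threshold w))) (sym (ℕ.n∸n≡0 n))

  -- The recurrence for the number of completions

  ≤ᵇ-true : ∀ {m n} → m ≤ n → (m ≤ᵇ n) ≡ true
  ≤ᵇ-true m≤n = Equivalence.to T-≡ (ℕ.≤⇒≤ᵇ m≤n)

  ≤ᵇ-false : ∀ {m n} → n < m → (m ≤ᵇ n) ≡ false
  ≤ᵇ-false {m} {n} n<m with m ≤ᵇ n in eq
  ... | false = refl
  ... | true  = contradiction (ℕ.≤ᵇ⇒≤ m n (Equivalence.from T-≡ eq)) (ℕ.<⇒≱ n<m)

  sumFrom : ℕ → ℕ → (ℕ → ℕ) → ℕ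
  sumFrom a n f = sumBelow n λ i → if a ≤ᵇ i then f i else 0

  sumFrom-empty : ∀ {a n} f → n ≤ a → sumFrom a n f ≡ 0
  sumFrom-empty {a} {n} f n≤a = sumBelow-zero n λ i i<n →
    cong (λ b → if b then f i else 0) (≤ᵇ-false (ℕ.<-≤-trans i<n n≤a))

  sumFrom-step : ∀ a n f → a < n → sumFrom a n f ≡ f a + sumFrom (suc a) n f
  sumFrom-step zero    (suc n) f _         = refl
  sumFrom-step (suc a) (suc n) f (s≤s a<n) = begin
    sumFrom (suc a) (suc n) f            ≡⟨ shift a f ⟩
    sumFrom a n (f ∘ suc)                ≡⟨ sumFrom-step a n (f ∘ suc) a<n ⟩
    f (suc a) + sumFrom (suc a) n (f ∘ suc)
      ≡⟨ cong (f (suc a) +_) (shift (suc a) f) ⟨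
    f (suc a) + sumFrom (suc (suc a)) (suc n) f ∎
    where
    open ≡.≡-Reasoning
    suc-≤ᵇ : ∀ a i → (suc a ≤ᵇ suc i) ≡ (a ≤ᵇ i)
    suc-≤ᵇ zero    i = refl
    suc-≤ᵇ (suc a) i = refl
    shift : ∀ a f → sumFrom (suc a) (suc n) f ≡ sumFrom a n (f ∘ suc)
    shift a f = sumBelow-cong n λ i _ → cong (λ b → if b then f (suc i) else 0) (suc-≤ᵇ a i)

  binomial-sum-cong : ∀ n {a b : ℕ → ℕ} → (∀ t → t ≤ n → a t ≡ b t) → binomial-sum n a ≡ binomial-sum n b
  binomial-sum-cong zero    h = h 0 z≤n
  binomial-sum-cong (suc n) h = cong₂ _+_ (binomial-sum-cong n λ t t≤n → h t (ℕ.m≤n⇒m≤1+n t≤n))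
    (binomial-sum-cong n λ t t≤n → h (suc t) (s≤s t≤n))

  binomial-sum-zero : ∀ n {a : ℕ → ℕ} → (∀ t → t ≤ n → a t ≡ 0) → binomial-sum n a ≡ 0
  binomial-sum-zero zero    h = h 0 z≤n
  binomial-sum-zero (suc n) h = cong₂ _+_ (binomial-sum-zero n λ t t≤n → h t (ℕ.m≤n⇒m≤1+n t≤n))
    (binomial-sum-zero n λ t t≤n → h (suc t) (s≤s t≤n))

  -- The binomial coefficient of the value at 0 is 1, so a change of that value passes unchanged to
  -- the sum.
  binomial-sum-head : ∀ n {a b : ℕ → ℕ} c → a 0 ≡ b 0 + c → (∀ t → a (suc t) ≡ b (suc t)) →
                      binomial-sum n a ≡ binomial-sum n b + c
  binomial-sum-head zero    c h₀ h = h₀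
  binomial-sum-head (suc n) {a} {b} c h₀ h = begin
    binomial-sum n a + binomial-sum n (a ∘ suc)
      ≡⟨ cong₂ _+_ (binomial-sum-head n c h₀ h) (binomial-sum-cong n λ t _ → h t) ⟩
    binomial-sum n b + c + binomial-sum n (b ∘ suc)
      ≡⟨ ℕ.+-assoc (binomial-sum n b) c _ ⟩
    binomial-sum n b + (c + binomial-sum n (b ∘ suc))
      ≡⟨ cong (binomial-sum n b +_) (ℕ.+-comm c _) ⟩
    binomial-sum n b + (binomial-sum n (b ∘ suc) + c)
      ≡⟨ ℕ.+-assoc (binomial-sum n b) _ c ⟨
    binomial-sum n b + binomial-sum n (b ∘ suc) + c ∎
    where open ≡.≡-Reasoning

  module _ (k : ℕ) where
    extensions-from : ∀ u a → a ≤ u → extensions k (suc u) a ≡ sumFrom a (suc u) (extensions k u)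
    extensions-from u a a≤u = sumBelow-cong (suc u) λ i _ →
      cong (λ b → if b then extensions k u i else 0) (begin
        (a ≤ᵇ i) ∨ ((k ≤ᵇ suc u) ∧ (suc u ≤ᵇ a)) ≡⟨ cong (λ b → (a ≤ᵇ i) ∨ ((k ≤ᵇ suc u) ∧ b)) (≤ᵇ-false (s≤s a≤u)) ⟩
        (a ≤ᵇ i) ∨ ((k ≤ᵇ suc u) ∧ false)        ≡⟨ cong ((a ≤ᵇ i) ∨_) (∧-zeroʳ (k ≤ᵇ suc u)) ⟩
        (a ≤ᵇ i) ∨ false                         ≡⟨ ∨-identityʳ (a ≤ᵇ i) ⟩
        (a ≤ᵇ i)                                 ∎)
      where open ≡.≡-Reasoning

    full : ℕ → ℕ
    full u = extensions k u u

    -- Splitting off the lowest admissible rank `a` leaves the tail sum for `suc a`. Both parts have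
    -- `d` smaller by one, in the pattern by which `binomial-sum` recurses.
    extensions-binomial : ∀ d a → extensions k (suc (d + a)) a ≡ binomial-sum d (λ t → full (t + a))
    extensions-binomial zero    a = begin
      extensions k (suc a) a                     ≡⟨ extensions-from a a ℕ.≤-refl ⟩
      sumFrom a (suc a) (extensions k a)         ≡⟨ sumFrom-step a (suc a) (extensions k a) ℕ.≤-refl ⟩
      full a + sumFrom (suc a) (suc a) (extensions k a)
        ≡⟨ cong (full a +_) (sumFrom-empty (extensions k a) (ℕ.≤-refl {suc a})) ⟩
      full a + 0                                 ≡⟨ ℕ.+-identityʳ (full a) ⟩
      full a                                     ∎
      where open ≡.≡-Reasoning
    extensions-binomial (suc d) a = begin
      extensions k (suc u) a                     ≡⟨ extensions-from u a a≤u ⟩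
      sumFrom a (suc u) (extensions k u)         ≡⟨ sumFrom-step a (suc u) (extensions k u) (s≤s a≤u) ⟩
      extensions k u a + sumFrom (suc a) (suc u) (extensions k u)
        ≡⟨ cong (extensions k u a +_) (extensions-from u (suc a) (s≤s (ℕ.m≤n+m a d))) ⟨
      extensions k u a + extensions k (suc u) (suc a)
        ≡⟨ cong₂ _+_ (extensions-binomial d a)
             (trans (cong (λ v → extensions k (suc v) (suc a)) (sym (ℕ.+-suc d a))) (extensions-binomial d (suc a))) ⟩
      binomial-sum d (λ t → full (t + a)) + binomial-sum d (λ t → full (t + suc a))
        ≡⟨ cong (binomial-sum d (λ t → full (t + a)) +_) (binomial-sum-cong d λ t _ → cong full (ℕ.+-suc t a)) ⟩
      binomial-sum (suc d) (λ t → full (t + a))  ∎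
      where
      open ≡.≡-Reasoning
      u : ℕ
      u = suc d + a
      a≤u : a ≤ u
      a≤u = ℕ.m≤n+m a (suc d)

    -- All ranks lie below `suc n`, so no letter makes a descent, while an ascent would fall within
    -- the first `k` letters.
    full-short : ∀ {n} → suc n < k → full (suc n) ≡ 0
    full-short {n} n<k = sumBelow-zero (suc n) λ i i<n → cong (λ b → if b then extensions k n i else 0)
      (cong₂ (λ b c → b ∨ (c ∧ (suc n ≤ᵇ suc n))) (≤ᵇ-false i<n) (≤ᵇ-false n<k))

    full-suc : ∀ {n} → k ≤ suc n → full (suc n) ≡ binomial-sum n full
    full-suc {n} k≤n = begin
      full (suc n)
        ≡⟨ (sumBelow-cong (suc n) λ i _ → cong (λ b → if b then extensions k n i else 0)
             (trans (cong₂ (λ b c → (suc n ≤ᵇ i) ∨ (b ∧ c)) (≤ᵇ-true k≤n) (≤ᵇ-true (ℕ.≤-refl {suc n})))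
               (∨-zeroʳ (suc n ≤ᵇ i)))) ⟩
      sumFrom 0 (suc n) (extensions k n)  ≡⟨ extensions-from n 0 z≤n ⟨
      extensions k (suc n) 0              ≡⟨ cong (λ m → extensions k (suc m) 0) (sym (ℕ.+-identityʳ n)) ⟩
      extensions k (suc (n + 0)) 0        ≡⟨ extensions-binomial n 0 ⟩
      binomial-sum n (λ t → full (t + 0)) ≡⟨ binomial-sum-cong n (λ t _ → cong full (ℕ.+-identityʳ t)) ⟩
      binomial-sum n full                 ∎
      where open ≡.≡-Reasoning

    full-recurrence : ∀ (a : ℕ → ℕ) → a 0 ≡ 1 → (∀ n → a (suc n) ≡ full (suc n)) → k ≤ 1 →
                      ∀ n → a (suc n) ≡ binomial-sum n a
    full-recurrence a a₀ a₊ k≤1 n = begin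
      a (suc n)           ≡⟨ a₊ n ⟩
      full (suc n)        ≡⟨ full-suc (ℕ.≤-trans k≤1 (s≤s z≤n)) ⟩
      binomial-sum n full ≡⟨ binomial-sum-cong n (λ { zero _ → sym a₀ ; (suc t) _ → sym (a₊ t) }) ⟩
      binomial-sum n a    ∎
      where open ≡.≡-Reasoning

    -- `full 0` is 1 but `a 0` is 0. When `k ≤ suc n`, correcting this one term of the binomial sum
    -- costs the summand 1; for smaller `n` all terms vanish.
    full-recurrence₀ : ∀ (a : ℕ → ℕ) → a 0 ≡ 0 → (∀ n → a (suc n) ≡ full (suc n)) → 1 ≤ k →
                       ∀ n → a (suc n) ≡ binomial-sum n a + indicator-from (k ∸ 1) n
    full-recurrence₀ a a₀ a₊ 1≤k n with k ∸ 1 ℕ.≤? n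
    ... | yes k≤n = begin
      a (suc n)                ≡⟨ a₊ n ⟩
      full (suc n)             ≡⟨ full-suc (subst (_≤ suc n) (ℕ.m+[n∸m]≡n 1≤k) (s≤s k≤n)) ⟩
      binomial-sum n full      ≡⟨ binomial-sum-head n 1 (cong (_+ 1) (sym a₀)) (λ t → sym (a₊ t)) ⟩
      binomial-sum n a + 1     ≡⟨ cong (λ b → binomial-sum n a + bit b) (≤ᵇ-true k≤n) ⟨
      binomial-sum n a + indicator-from (k ∸ 1) n ∎
      where open ≡.≡-Reasoning
    ... | no k≰n = begin
      a (suc n)                ≡⟨ a₊ n ⟩
      full (suc n)             ≡⟨ full-short 1+n<k ⟩
      0 + 0
        ≡⟨ cong₂ _+_ (binomial-sum-zero n vanish) (cong bit (≤ᵇ-false (ℕ.≰⇒> k≰n))) ⟨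
      binomial-sum n a + indicator-from (k ∸ 1) n ∎
      where
      open ≡.≡-Reasoning
      1+n<k : suc n < k
      1+n<k = subst (suc n <_) (ℕ.m+[n∸m]≡n 1≤k) (s≤s (ℕ.≰⇒> k≰n))
      vanish : ∀ t → t ≤ n → a t ≡ 0
      vanish zero    _   = a₀
      vanish (suc t) t<n = trans (a₊ t) (full-short (ℕ.<-≤-trans (s≤s t<n) (ℕ.<⇒≤ 1+n<k)))

  -- Valid words are the permutations to be counted

  open Equivalence using (to; from)

  module Characterisation (k n : ℕ) where
    _∉_ : ∀ {m} → Fin n → Word n m → Set
    e ∉ w = ∀ i → e ≢ lookup w i

    unused⇔∉ : ∀ {m} (w : Word n m) e → unused k n w e ≡ true ⇔ e ∉ w
    unused⇔∉ []      e = mk⇔ (λ _ ()) (λ _ → refl)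
    unused⇔∉ (c ∷ w) e = mk⇔ ⇒ ⇐
      where
      ⇒ : remove (unused k n w) c e ≡ true → e ∉ (c ∷ w)
      ⇒ h i with unused k n w e in ue | e Fin.≟ c
      ⇒ h zero    | true | no e≢c = e≢c
      ⇒ h (suc i) | true | no e≢c = to (unused⇔∉ w e) ue i
      ⇐ : e ∉ (c ∷ w) → remove (unused k n w) c e ≡ true
      ⇐ h = cong₂ (λ b d → b ∧ not d) (from (unused⇔∉ w e) (h ∘ suc)) (dec-false (e Fin.≟ c) (h zero))

    -- `extends` expressed through letters instead of ranks.
    Step : ∀ {m} → Fin n → Word n m → Set
    Step {m} c w = threshold k n w ≤ toℕ c ⊎ (k ≤ n ∸ m × (∀ e → e ∉ w → toℕ e < threshold k n w))

    Valid : ∀ {m} → Word n m → Set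
    Valid []      = ⊤
    Valid (c ∷ w) = Valid w × c ∉ w × Step c w

    valid⇔Valid : ∀ {m} (w : Word n m) → T (valid k n w) ⇔ Valid w
    valid⇔Valid []      = mk⇔ id id
    valid⇔Valid {suc m} (c ∷ w) = mk⇔ ⇒ ⇐
      where
      U : Fin n → Bool
      U = unused k n w
      a : ℕ
      a = below U (threshold k n w)

      n∸m : Valid w → below U n ≡ n ∸ m
      n∸m v = unused-count k n w (to T-≡ (from (valid⇔Valid w) v))

      ⇒ : T (valid k n (c ∷ w)) → Valid (c ∷ w)
      ⇒ t with to (T-∧ {valid k n w}) t
      ... | tw , tc with to (T-∧ {U c}) tc
      ... | tu , ts = v , to (unused⇔∉ w c) Uc , step (to (T-∨ {a ≤ᵇ below U (toℕ c)}) ts)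
        where
        v : Valid w
        v = to (valid⇔Valid w) tw
        Uc : U c ≡ true
        Uc = to T-≡ tu
        step : T (a ≤ᵇ below U (toℕ c)) ⊎ T ((k ≤ᵇ n ∸ m) ∧ (n ∸ m ≤ᵇ a)) → Step c w
        step (inj₁ h) = inj₁ (to (below-≤⇔ U c (threshold k n w) Uc) (ℕ.≤ᵇ⇒≤ a _ h))
        step (inj₂ h) with to (T-∧ {k ≤ᵇ n ∸ m}) h
        ... | h₁ , h₂ = inj₂ (ℕ.≤ᵇ⇒≤ k (n ∸ m) h₁ , λ e e∉w →
          to (below-full⇔ U (threshold k n w)) (subst (_≤ a) (sym (n∸m v)) (ℕ.≤ᵇ⇒≤ (n ∸ m) a h₂))
            e (from (unused⇔∉ w e) e∉w))

      ⇐ : Valid (c ∷ w) → T (valid k n (c ∷ w))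
      ⇐ (v , c∉w , s) = from (T-∧ {valid k n w}) (from (valid⇔Valid w) v ,
        from (T-∧ {U c}) (from T-≡ Uc , from (T-∨ {a ≤ᵇ below U (toℕ c)}) (step s)))
        where
        Uc : U c ≡ true
        Uc = from (unused⇔∉ w c) c∉w
        step : Step c w → T (a ≤ᵇ below U (toℕ c)) ⊎ T ((k ≤ᵇ n ∸ m) ∧ (n ∸ m ≤ᵇ a))
        step (inj₁ h) = inj₁ (ℕ.≤⇒≤ᵇ (from (below-≤⇔ U c (threshold k n w) Uc) h))
        step (inj₂ (k≤ , h)) = inj₂ (from (T-∧ {k ≤ᵇ n ∸ m}) (ℕ.≤⇒≤ᵇ k≤ , ℕ.≤⇒≤ᵇ (subst (_≤ a) (n∸m v)
          (from (below-full⇔ U (threshold k n w)) λ e Ue → h e (to (unused⇔∉ w e) Ue)))))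

    -- For a suffix `w` of a permutation of length `n`, the position of the letter `j⁺` in the whole
    -- permutation is `n ∸ m + toℕ j⁺`, and the letters absent from `j⁺` onwards are those that
    -- precede it.
    Adjacent : ∀ {m} → Word n m → Fin m → Fin m → Set
    Adjacent {m} w j j⁺ = lookup w j⁺ Fin.< lookup w j ⊎
      (k ≤ n ∸ m + toℕ j⁺ × (∀ e → (∀ i → j⁺ Fin.≤ i → e ≢ lookup w i) → e Fin.< lookup w j⁺))

    Steps : ∀ {m} → Word n m → Set
    Steps {m} w = ∀ (j j⁺ : Fin m) → toℕ j⁺ ≡ suc (toℕ j) → Adjacent w j j⁺

    Unique-∷ : ∀ {m c} {w : Word n m} → Unique (c ∷ w) ⇔ (c ∉ w × Unique w)
    Unique-∷ = mk⇔ (λ { (p ∷ u) → All.lookup⁺ p , u }) (λ { (p , u) → All.lookup⁻ p ∷ u })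

    -- The induction starts from a one-letter suffix: its step, taken against the value `n` of
    -- `threshold`, yields `k ≤ n` and no adjacent pair. Every further letter contributes one pair.
    Valid⇔ : ∀ {m} → m < n → (w : Word n (suc m)) → Valid w ⇔ (Unique w × k ≤ n × Steps w)
    Valid⇔ _ (c ∷ []) = mk⇔ ⇒ ⇐
      where
      ⇒ : Valid (c ∷ []) → Unique (c ∷ []) × k ≤ n × Steps (c ∷ [])
      ⇒ (_ , _ , inj₁ n≤c)       = contradiction (Fin.toℕ<n c) (ℕ.≤⇒≯ n≤c)
      ⇒ (_ , _ , inj₂ (k≤n , _)) = [] ∷ [] , k≤n , λ { zero zero () }
      ⇐ : Unique (c ∷ []) × k ≤ n × Steps (c ∷ []) → Valid (c ∷ [])
      ⇐ (_ , k≤n , _) = tt , (λ ()) , inj₂ (k≤n , λ e _ → Fin.toℕ<n e)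
    Valid⇔ {suc m} m<n (c ∷ w@(d ∷ w′)) = mk⇔ ⇒ ⇐
      where
      rec = Valid⇔ (ℕ.<⇒≤ m<n) w
      n∸m : n ∸ suc m ≡ suc (n ∸ suc (suc m))
      n∸m = ℕ.+-∸-assoc 1 m<n
      shift : ∀ j → n ∸ suc m + j ≡ n ∸ suc (suc m) + suc j
      shift j = trans (cong (_+ j) n∸m) (sym (ℕ.+-suc (n ∸ suc (suc m)) j))

      ⇒ : Valid (c ∷ w) → Unique (c ∷ w) × k ≤ n × Steps (c ∷ w)
      ⇒ (v , c∉w , s) with to rec v
      ... | u , k≤n , steps = from Unique-∷ (c∉w , u) , k≤n , steps′ s
        where
        steps′ : Step c w → Steps (c ∷ w)
        steps′ (inj₁ d≤c) zero (suc zero) _ = inj₁ (ℕ.≤∧≢⇒< d≤c (λ d≡c → c∉w zero (sym (Fin.toℕ-injective d≡c))))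
        steps′ (inj₂ (k≤ , h)) zero (suc zero) _ = inj₂ (subst (k ≤_) (trans (sym (ℕ.+-identityʳ _)) (shift 0)) k≤ ,
          λ e e∉ → h e λ i → e∉ (suc i) (s≤s z≤n))
        steps′ _ (suc j) (suc j⁺) eq with steps j j⁺ (ℕ.suc-injective eq)
        ... | inj₁ lt = inj₁ lt
        ... | inj₂ (k≤ , h) = inj₂ (subst (k ≤_) (shift (toℕ j⁺)) k≤ , λ e e∉ → h e λ i j⁺≤i → e∉ (suc i) (s≤s j⁺≤i))

      ⇐ : Unique (c ∷ w) × k ≤ n × Steps (c ∷ w) → Valid (c ∷ w)
      ⇐ (u , k≤n , steps) with to Unique-∷ u
      ... | c∉w , u′ = from rec (u′ , k≤n , steps′) , c∉w , step
        where
        steps′ : Steps w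
        steps′ j j⁺ eq with steps (suc j) (suc j⁺) (cong suc eq)
        ... | inj₁ lt = inj₁ lt
        ... | inj₂ (k≤ , h) = inj₂ (subst (k ≤_) (sym (shift (toℕ j⁺))) k≤ ,
          λ e e∉ → h e λ { (suc i) (s≤s j⁺≤i) → e∉ i j⁺≤i })
        step : Step c w
        step with steps zero (suc zero) refl
        ... | inj₁ d<c = inj₁ (ℕ.<⇒≤ d<c)
        ... | inj₂ (k≤ , h) = inj₂ (subst (k ≤_) (trans (sym (shift 0)) (ℕ.+-identityʳ _)) k≤ ,
          λ e e∉ → h e λ { (suc i) _ → e∉ i })

  module _ {n : ℕ} where
    -- A missed value could be punched out, leaving an injection into a smaller set. This is used to
    -- locate a letter that does not occur from a given position on.
    injective⇒surjective : (f : Fin n → Fin n) → (∀ i j → f i ≡ f j → i ≡ j) → ∀ e → ∃ λ i → e ≡ f i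
    injective⇒surjective f inj e with Fin.any? (λ i → e Fin.≟ f i)
    ... | yes p = p
    ... | no ¬p = contradiction (f , inj) (avoids n f e ¬p)
      where
      avoids : ∀ n (f : Fin n → Fin n) e → ¬ (∃ λ i → e ≡ f i) → ¬ (∃ λ (g : Fin n → Fin n) → ∀ i j → f i ≡ f j → i ≡ j)
      avoids (suc n) f e ¬p (_ , inj) = ℕ.1+n≰n (Fin.injective⇒≤ {f = λ i → Fin.punchOut (λ eq → ¬p (i , eq))}
        λ {i} {j} eq → inj i j (Fin.punchOut-injective (λ q → ¬p (i , q)) (λ q → ¬p (j , q)) eq))

    private
      both : ∀ {A B : Set} → A → B → A ⇔ B
      both a b = mk⇔ (λ _ → b) (λ _ → a)
      neither : ∀ {A B : Set} → ¬ A → ¬ B → A ⇔ B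
      neither ¬a ¬b = mk⇔ (λ a → contradiction a ¬a) (λ b → contradiction b ¬b)

    312⇔ : ∀ (a b c : Fin n) → OrderIsomorphic (a ∷ b ∷ c ∷ []) p312 ⇔ (b Fin.< c × c Fin.< a)
    312⇔ a b c = mk⇔
      (λ iso → from (iso (suc zero) (suc (suc zero))) (s≤s z≤n) , from (iso (suc (suc zero)) zero) (s≤s (s≤s z≤n)))
      λ (b<c , c<a) → iso b<c c<a
      where
      iso : b Fin.< c → c Fin.< a → OrderIsomorphic (a ∷ b ∷ c ∷ []) p312
      iso b<c c<a zero             zero             = neither (ℕ.<-irrefl refl) (ℕ.<-irrefl refl)
      iso b<c c<a zero             (suc zero)       = neither (ℕ.<-asym (ℕ.<-trans b<c c<a)) λ ()
      iso b<c c<a zero             (suc (suc zero)) = neither (ℕ.<-asym c<a) λ { (s≤s ()) }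
      iso b<c c<a (suc zero)       zero             = both (ℕ.<-trans b<c c<a) (s≤s z≤n)
      iso b<c c<a (suc zero)       (suc zero)       = neither (ℕ.<-irrefl refl) (ℕ.<-irrefl refl)
      iso b<c c<a (suc zero)       (suc (suc zero)) = both b<c (s≤s z≤n)
      iso b<c c<a (suc (suc zero)) zero             = both c<a (s≤s (s≤s z≤n))
      iso b<c c<a (suc (suc zero)) (suc zero)       = neither (ℕ.<-asym b<c) λ ()
      iso b<c c<a (suc (suc zero)) (suc (suc zero)) = neither (ℕ.<-irrefl refl) (ℕ.<-irrefl refl)

  opposite-<⇔ : ∀ {k} (i j : Fin k) → opposite i Fin.< opposite j ⇔ j Fin.< i
  opposite-<⇔ {k} i j = mk⇔
    (λ h → ℕ.≰⇒> λ i≤j → ℕ.<⇒≱ (subst₂ _<_ (Fin.opposite-prop i) (Fin.opposite-prop j) h)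
      (ℕ.∸-monoʳ-≤ k (s≤s i≤j)))
    (λ j<i → subst₂ _<_ (sym (Fin.opposite-prop i)) (sym (Fin.opposite-prop j))
      (ℕ.∸-monoʳ-< (s≤s j<i) (Fin.toℕ<n i)))

  module _ (k n : ℕ) (w : Word (suc n) (suc n)) where
    open Characterisation k (suc n)

    private
      π : Fin (suc n) → Fin (suc n)
      π = lookup w

      front : k ≤ suc n → Fin k → Fin (suc n)
      front k≤ i = inject≤ i k≤

    Decreasing : k ≤ suc n → Set
    Decreasing k≤ = ∀ i j → i Fin.< j → π (front k≤ j) Fin.< π (front k≤ i)

    prefix⇔ : Unique w → (k≤ : k ≤ suc n) →
      OrderIsomorphic (tabulate (λ i → π (front k≤ i))) (descending k) ⇔ Decreasing k≤
    prefix⇔ u k≤ = mk⇔ ⇒ ⇐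
      where
      ⇒ : OrderIsomorphic (tabulate (λ i → π (front k≤ i))) (descending k) → Decreasing k≤
      ⇒ iso i j i<j = subst₂ Fin._<_ (Vec.lookup∘tabulate (π ∘ front k≤) j) (Vec.lookup∘tabulate (π ∘ front k≤) i)
        (from (iso j i) (subst₂ Fin._<_ (sym (Vec.lookup∘tabulate opposite j)) (sym (Vec.lookup∘tabulate opposite i))
          (from (opposite-<⇔ j i) i<j)))
      ⇐ : Decreasing k≤ → OrderIsomorphic (tabulate (λ i → π (front k≤ i))) (descending k)
      ⇐ dec i j = mk⇔
        (λ h → subst₂ Fin._<_ (sym (Vec.lookup∘tabulate opposite i)) (sym (Vec.lookup∘tabulate opposite j))
          (from (opposite-<⇔ i j) (j<i (subst₂ Fin._<_ (Vec.lookup∘tabulate (π ∘ front k≤) i)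
            (Vec.lookup∘tabulate (π ∘ front k≤) j) h))))
        (λ h → subst₂ Fin._<_ (sym (Vec.lookup∘tabulate (π ∘ front k≤) i)) (sym (Vec.lookup∘tabulate (π ∘ front k≤) j))
          (dec j i (to (opposite-<⇔ i j) (subst₂ Fin._<_ (Vec.lookup∘tabulate opposite i)
            (Vec.lookup∘tabulate opposite j) h))))
        where
        j<i : π (front k≤ i) Fin.< π (front k≤ j) → j Fin.< i
        j<i h with Fin.<-cmp i j
        ... | tri< i<j _ _  = contradiction (dec i j i<j) (ℕ.<-asym h)
        ... | tri≈ _ refl _ = contradiction h (ℕ.<-irrefl refl)
        ... | tri> _ _ j<i  = j<i

    Good : Set
    Good = IsPermutation w × Avoids3-12 w × BeginsWith (descending k) w

    -- An earlier letter that exceeds an ascent top is not the ascent bottom, so it stands before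
    -- the ascent and forms 3-12 with it. The first `k` letters decrease iff no ascent top has a
    -- position below `k`, whence the bound in `Adjacent`.
    Good⇔ : Good ⇔ (Unique w × k ≤ suc n × Steps w)
    Good⇔ = mk⇔ ⇒ ⇐
      where
      n∸n+ : ∀ j → suc n ∸ suc n + j ≡ j
      n∸n+ j = cong (_+ j) (ℕ.n∸n≡0 n)

      ⇒ : Good → Unique w × k ≤ suc n × Steps w
      ⇒ (_ , _ , inj₂ (_ , ()))
      ⇒ (u , avoids , inj₁ (k≤ , iso)) = u , k≤ , steps
        where
        inj : ∀ i j → π i ≡ π j → i ≡ j
        inj = lookup-injective u

        steps : Steps w
        steps j j⁺ eq with Fin.<-cmp (π j) (π j⁺)
        ... | tri> _ _ lt = inj₁ lt
        ... | tri≈ _ πj≡ _ = contradiction (cong toℕ (inj j j⁺ πj≡)) (ℕ.<⇒≢ (subst (toℕ j <_) (sym eq) ℕ.≤-refl))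
        ... | tri< lt _ _ = inj₂ (subst (k ≤_) (sym (n∸n+ (toℕ j⁺))) (ℕ.≮⇒≥ k≤j⁺) , maximal)
          where
          k≤j⁺ : ¬ (toℕ j⁺ < k)
          k≤j⁺ j⁺<k = ℕ.<-asym lt (subst₂ (λ a b → π a Fin.< π b) (at j⁺ j⁺<k) (at j j<k)
            (to (prefix⇔ u k≤) iso (Fin.fromℕ< j<k) (Fin.fromℕ< j⁺<k)
              (subst₂ _<_ (sym (Fin.toℕ-fromℕ< j<k)) (sym (Fin.toℕ-fromℕ< j⁺<k)) j<j⁺)))
            where
            j<j⁺ : toℕ j < toℕ j⁺
            j<j⁺ = subst (toℕ j <_) (sym eq) ℕ.≤-refl
            j<k : toℕ j < k
            j<k = ℕ.<-trans j<j⁺ j⁺<k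
            at : ∀ (i : Fin (suc n)) (i<k : toℕ i < k) → front k≤ (Fin.fromℕ< i<k) ≡ i
            at i i<k = Fin.toℕ-injective (trans (Fin.toℕ-inject≤ (Fin.fromℕ< i<k) k≤) (Fin.toℕ-fromℕ< i<k))

          maximal : ∀ e → (∀ i → j⁺ Fin.≤ i → e ≢ π i) → e Fin.< π j⁺
          maximal e e∉ with injective⇒surjective π inj e
          ... | i , refl with Fin.<-cmp (π i) (π j⁺)
          ... | tri< lt′ _ _ = lt′
          ... | tri≈ _ πi≡ _ = contradiction πi≡ (e∉ j⁺ ℕ.≤-refl)
          ... | tri> _ _ gt  = contradiction (i , j , j⁺ , i<j , eq , from (312⇔ (π i) (π j) (π j⁺)) (lt , gt)) avoids
            where
            i≤j : toℕ i ≤ toℕ j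
            i≤j = ℕ.s≤s⁻¹ (subst (toℕ i <_) eq (ℕ.≰⇒> λ j⁺≤i → e∉ i j⁺≤i refl))
            i<j : i Fin.< j
            i<j = ℕ.≤∧≢⇒< i≤j λ i≡j → ℕ.<-asym lt (subst (λ l → π j⁺ Fin.< π l) (Fin.toℕ-injective i≡j) gt)

      ⇐ : Unique w × k ≤ suc n × Steps w → Good
      ⇐ (u , k≤ , steps) = u , avoids , inj₁ (k≤ , from (prefix⇔ u k≤) decreasing)
        where
        avoids : Avoids3-12 w
        avoids (i , j , j⁺ , i<j , eq , iso) with to (312⇔ (π i) (π j) (π j⁺)) iso | steps j j⁺ eq
        ... | lt , gt | inj₁ lt′ = ℕ.<-asym lt lt′
        ... | lt , gt | inj₂ (_ , maximal) = ℕ.<-asym gt (maximal (π i) λ l j⁺≤l πi≡πl →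
          ℕ.<⇒≱ (ℕ.<-trans i<j (subst (toℕ j <_) (sym eq) ℕ.≤-refl))
            (subst (toℕ j⁺ ≤_) (cong toℕ (sym (lookup-injective u i l πi≡πl))) j⁺≤l))

        descent : ∀ j j⁺ → toℕ j⁺ ≡ suc (toℕ j) → toℕ j⁺ < k → π j⁺ Fin.< π j
        descent j j⁺ eq j⁺<k with steps j j⁺ eq
        ... | inj₁ lt       = lt
        ... | inj₂ (k≤j⁺ , _) = contradiction (subst (k ≤_) (n∸n+ (toℕ j⁺)) k≤j⁺) (ℕ.<⇒≱ j⁺<k)

        descents : ∀ d i j → toℕ j ≡ suc (d + toℕ i) → toℕ j < k → π j Fin.< π i
        descents zero    i j eq j<k = descent i j eq j<k
        descents (suc d) i j eq j<k = ℕ.<-trans (descent j⁻ j (trans eq (cong suc (sym toℕ-j⁻))) j<k)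
          (descents d i j⁻ toℕ-j⁻ (ℕ.<-trans (ℕ.≤-reflexive (trans (cong suc toℕ-j⁻) (sym eq))) j<k))
          where
          <n : suc (d + toℕ i) < suc n
          <n = ℕ.<-trans (ℕ.≤-reflexive (sym eq)) (Fin.toℕ<n j)
          j⁻ : Fin (suc n)
          j⁻ = Fin.fromℕ< <n
          toℕ-j⁻ : toℕ j⁻ ≡ suc (d + toℕ i)
          toℕ-j⁻ = Fin.toℕ-fromℕ< <n

        decreasing : Decreasing k≤
        decreasing i j i<j = descents (toℕ j ∸ suc (toℕ i)) (front k≤ i) (front k≤ j)
          (begin
            toℕ (front k≤ j)                          ≡⟨ Fin.toℕ-inject≤ j k≤ ⟩
            toℕ j                                     ≡⟨ ℕ.m∸n+n≡m i<j ⟨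
            toℕ j ∸ suc (toℕ i) + suc (toℕ i)         ≡⟨ ℕ.+-suc (toℕ j ∸ suc (toℕ i)) (toℕ i) ⟩
            suc (toℕ j ∸ suc (toℕ i) + toℕ i)         ≡⟨ cong (λ l → suc (toℕ j ∸ suc (toℕ i) + l)) (Fin.toℕ-inject≤ i k≤) ⟨
            suc (toℕ j ∸ suc (toℕ i) + toℕ (front k≤ i)) ∎)
          (subst (_< k) (sym (Fin.toℕ-inject≤ j k≤)) (Fin.toℕ<n j))
          where open ≡.≡-Reasoning

    Good⇔valid : Good ⇔ T (valid k (suc n) w)
    Good⇔valid = mk⇔
      (λ g → from (valid⇔Valid w) (from (Valid⇔ ℕ.≤-refl w) (to Good⇔ g)))
      (λ t → from Good⇔ (to (Valid⇔ ℕ.≤-refl w) (to (valid⇔Valid w) t)))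

  -- Only nonempty permutations are compared: at 0 the right-hand side would be 1 for every `k`,
  -- while `N` follows the convention on the empty permutation.
  N-suc≡full : ∀ k n → N (descending k) (suc n) ≡ full k (suc n)
  N-suc≡full k n = trans
    (length-filter _ (valid k (suc n)) (Good⇔valid k n) (words (suc n) (suc n)))
    (count-valid k (suc n))

  N₁-zero : N (descending 1) 0 ≡ 1
  N₁-zero = refl

  N-zero : ∀ k → 2 ≤ k → N (descending k) 0 ≡ 0
  N-zero (suc zero)    (s≤s ())
  N-zero (suc (suc k)) _ = refl

  N₁-suc : ∀ n → N (descending 1) (suc n) ≡ binomial-sum n (N (descending 1))
  N₁-suc = full-recurrence 1 (N (descending 1)) N₁-zero (N-suc≡full 1) ℕ.≤-refl

  N-suc : ∀ k → 2 ≤ k → ∀ n →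
          N (descending k) (suc n) ≡ binomial-sum n (N (descending k)) + indicator-from (k ∸ 1) n
  N-suc k 2≤k = full-recurrence₀ k (N (descending k)) (N-zero k 2≤k) (N-suc≡full k) (ℕ.<⇒≤ 2≤k)

-- Formal power series

-- The base ring is kept general because the calculus is needed twice: over ℚ for the partial sums
-- of an exponential and over ℝ for their limits.
module FormalSeries (R : CommutativeRing 0ℓ 0ℓ) where
  open CommutativeRing R
  open SemiringSum semiring using (sum; sum-cong-≋; *-distribˡ-sum; ∑-distrib-+)
  private
    module P = RawRing (powerSeries rawRing)
    S : Set
    S = P.Carrier

  tail : S → S
  tail f = f ∘ suc

  infixl 7 _•_
  _•_ : Carrier → S → S
  (c • f) n = c * f n

  -- By computation, coefficient `suc n` of `f P.* g` is `f 0 * g (suc n)` plus coefficient `n` of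
  -- `tail f P.* g`. The ring laws below are inductions along this unfolding.
  conv-cong : ∀ {f f′ g g′} → f P.≈ f′ → g P.≈ g′ → f P.* g P.≈ f′ P.* g′
  conv-cong p q zero    = +-cong (*-cong (p 0) (q 0)) refl
  conv-cong p q (suc n) = +-cong (*-cong (p 0) (q (suc n))) (conv-cong (p ∘ suc) q n)

  conv-zeroˡ : ∀ {f} g → f P.≈ P.0# → f P.* g P.≈ P.0#
  conv-zeroˡ g p zero    = trans (+-cong (trans (*-cong (p 0) refl) (zeroˡ _)) refl) (+-identityˡ _)
  conv-zeroˡ g p (suc n) = trans (+-cong (trans (*-cong (p 0) refl) (zeroˡ _)) (conv-zeroˡ g (p ∘ suc) n))
    (+-identityˡ _)

  module _ where
    open import Relation.Binary.Reasoning.Setoid setoid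
    open RingSolver commutativeSemiring using (solve; _:=_; _:+_; _:*_; con)

    conv-distribʳ : ∀ h f g → (f P.+ g) P.* h P.≈ f P.* h P.+ g P.* h
    conv-distribʳ h f g zero    =
      trans (+-congʳ (distribʳ (h 0) (f 0) (g 0))) (solve 2 (λ a b → a :+ b :+ con 0 := (a :+ con 0) :+ (b :+ con 0)) refl _ _)
    conv-distribʳ h f g (suc n) = begin
      (f 0 + g 0) * h (suc n) + (tail (f P.+ g) P.* h) n
        ≈⟨ +-congˡ (conv-distribʳ h (tail f) (tail g) n) ⟩
      (f 0 + g 0) * h (suc n) + ((tail f P.* h) n + (tail g P.* h) n)
        ≈⟨ solve 5 (λ a b c d e → (a :+ b) :* c :+ (d :+ e) := (a :* c :+ d) :+ (b :* c :+ e)) refl _ _ _ _ _ ⟩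
      (f P.* h P.+ g P.* h) (suc n) ∎

    conv-• : ∀ c f g → (c • f) P.* g P.≈ c • (f P.* g)
    conv-• c f g zero    = solve 3 (λ a b c → (a :* b) :* c :+ con 0 := a :* (b :* c :+ con 0)) refl _ _ _
    conv-• c f g (suc n) = begin
      c * f 0 * g (suc n) + (tail (c • f) P.* g) n ≈⟨ +-congˡ (conv-• c (tail f) g n) ⟩
      c * f 0 * g (suc n) + c * (tail f P.* g) n
        ≈⟨ solve 4 (λ a b c d → a :* b :* c :+ a :* d := a :* (b :* c :+ d)) refl _ _ _ _ ⟩
      c * (f P.* g) (suc n) ∎

    conv-assoc : ∀ f g h → (f P.* g) P.* h P.≈ f P.* (g P.* h)
    conv-assoc f g h zero    =
      solve 3 (λ a b c → (a :* b :+ con 0) :* c :+ con 0 := a :* (b :* c :+ con 0) :+ con 0) refl _ _ _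
    conv-assoc f g h (suc n) = begin
      (f P.* g) 0 * h (suc n) + ((f 0 • tail g P.+ tail f P.* g) P.* h) n
        ≈⟨ +-congˡ (conv-distribʳ h (f 0 • tail g) (tail f P.* g) n) ⟩
      (f P.* g) 0 * h (suc n) + (((f 0 • tail g) P.* h) n + ((tail f P.* g) P.* h) n)
        ≈⟨ +-congˡ (+-cong (conv-• (f 0) (tail g) h n) (conv-assoc (tail f) g h n)) ⟩
      (f 0 * g 0 + 0#) * h (suc n) + (f 0 * (tail g P.* h) n + (tail f P.* (g P.* h)) n)
        ≈⟨ solve 5 (λ a b c d e → (a :* b :+ con 0) :* c :+ (a :* d :+ e) := a :* (b :* c :+ d) :+ e)
             refl _ _ _ _ _ ⟩
      (f P.* (g P.* h)) (suc n) ∎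

    -- Peels off the last summand instead of the first, the mirror image needed for commutativity
    -- and for the product rule.
    conv-suc : ∀ f g n → (f P.* g) (suc n) ≈ (f P.* tail g) n + f (suc n) * g 0
    conv-suc f g zero    = solve 2 (λ a b → a :+ (b :+ con 0) := (a :+ con 0) :+ b) refl _ _
    conv-suc f g (suc n) = trans (+-congˡ (conv-suc (tail f) g n)) (sym (+-assoc _ _ _))

    conv-comm : ∀ f g → f P.* g P.≈ g P.* f
    conv-comm f g zero    = +-congʳ (*-comm _ _)
    conv-comm f g (suc n) = begin
      f 0 * g (suc n) + (tail f P.* g) n ≈⟨ +-cong (*-comm _ _) (conv-comm (tail f) g n) ⟩
      g (suc n) * f 0 + (g P.* tail f) n ≈⟨ +-comm _ _ ⟩
      (g P.* tail f) n + g (suc n) * f 0 ≈⟨ conv-suc g f n ⟨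
      (g P.* f) (suc n) ∎

  conv-identityˡ : ∀ f → P.1# P.* f P.≈ f
  conv-identityˡ f zero    = trans (+-identityʳ _) (*-identityˡ _)
  conv-identityˡ f (suc n) = trans (+-cong (*-identityˡ _) (conv-zeroˡ f (λ _ → refl) n)) (+-identityʳ _)

  series-commutativeRing : CommutativeRing 0ℓ 0ℓ
  series-commutativeRing = record
    { Carrier = S ; _≈_ = P._≈_ ; _+_ = P._+_ ; _*_ = P._*_ ; -_ = P.-_ ; 0# = P.0# ; 1# = P.1#
    ; isCommutativeRing = record
      { isRing = record
        { +-isAbelianGroup = record
          { isGroup = record
            { isMonoid = record
              { isSemigroup = record
                { isMagma = record
                  { isEquivalence = record
                    { refl = λ _ → refl ; sym = λ p n → sym (p n) ; trans = λ p q n → trans (p n) (q n) }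
                  ; ∙-cong = λ p q n → +-cong (p n) (q n) }
                ; assoc = λ f g h n → +-assoc (f n) (g n) (h n) }
              ; identity = (λ f n → +-identityˡ (f n)) , (λ f n → +-identityʳ (f n)) }
            ; inverse = (λ f n → -‿inverseˡ (f n)) , (λ f n → -‿inverseʳ (f n))
            ; ⁻¹-cong = λ p n → -‿cong (p n) }
          ; comm = λ f g n → +-comm (f n) (g n) }
        ; *-cong = λ {f} {f′} {g} {g′} p q → conv-cong {f} {f′} {g} {g′} p q
        ; *-assoc = conv-assoc
        ; *-identity = conv-identityˡ , λ f n → trans (conv-comm f P.1# n) (conv-identityˡ f n)
        ; distrib = (λ f g h n → trans (conv-comm f (g P.+ h) n) (trans (conv-distribʳ f g h n)
              (+-cong (conv-comm g f n) (conv-comm h f n)))) , conv-distribʳ }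
      ; *-comm = conv-comm } }

  -- `ν n` is the image of the integer n in the ring, and `μ n` is that of 1/(n+1), by which a
  -- coefficient is recovered from the derivative.
  module Calculus
    (ν : ℕ → Carrier) (ν-zero : ν 0 ≈ 0#) (ν-suc : ∀ n → ν (suc n) ≈ 1# + ν n)
    (μ : ℕ → Carrier) (ν*μ : ∀ n → ν (suc n) * μ n ≈ 1#)
    where

    module _ where
      open import Relation.Binary.Reasoning.Setoid setoid
      open RingSolver commutativeSemiring using (solve; _:=_; _:+_; _:*_; con)

      ν-+ : ∀ m n → ν (m ℕ.+ n) ≈ ν m + ν n
      ν-+ zero    n = sym (trans (+-congʳ ν-zero) (+-identityˡ _))
      ν-+ (suc m) n = begin
        ν (suc (m ℕ.+ n))   ≈⟨ ν-suc (m ℕ.+ n) ⟩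
        1# + ν (m ℕ.+ n)    ≈⟨ +-congˡ (ν-+ m n) ⟩
        1# + (ν m + ν n)    ≈⟨ +-assoc _ _ _ ⟨
        1# + ν m + ν n      ≈⟨ +-congʳ (ν-suc m) ⟨
        ν (suc m) + ν n     ∎

      ν-cancel : ∀ n {x y} → ν (suc n) * x ≈ ν (suc n) * y → x ≈ y
      ν-cancel n {x} {y} p = begin
        x                       ≈⟨ lemma x ⟩
        μ n * (ν (suc n) * x)   ≈⟨ *-congˡ p ⟩
        μ n * (ν (suc n) * y)   ≈⟨ lemma y ⟨
        y                       ∎
        where
        lemma : ∀ z → z ≈ μ n * (ν (suc n) * z)
        lemma z = begin
          z                       ≈⟨ *-identityˡ z ⟨
          1# * z                  ≈⟨ *-congʳ (ν*μ n) ⟨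
          ν (suc n) * μ n * z     ≈⟨ solve 3 (λ a b c → a :* b :* c := b :* (a :* c)) refl _ _ _ ⟩
          μ n * (ν (suc n) * z)   ∎

      -- `θ` is x d/dx. It preserves degrees, so its product rule holds summand by summand from n =
      -- i + (n - i); `D` is d/dx, obtained by shifting the index.
      θ D : S → S
      θ f n = ν n * f n
      D f = tail (θ f)

      D-cong : ∀ {f g} → f P.≈ g → D f P.≈ D g
      D-cong p n = *-congˡ (p (suc n))

      ν*[x*μ] : ∀ n x → ν (suc n) * (x * μ n) ≈ x
      ν*[x*μ] n x = trans (solve 3 (λ a b c → a :* (b :* c) := b :* (a :* c)) refl _ _ _)
        (trans (*-congˡ (ν*μ n)) (*-identityʳ _))

      θ-* : ∀ f g → θ (f P.* g) P.≈ θ f P.* g P.+ f P.* θ g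
      θ-* f g n = begin
        ν n * sum {suc n} (λ i → t (toℕ i))       ≈⟨ *-distribˡ-sum {suc n} (ν n) (λ i → t (toℕ i)) ⟩
        sum {suc n} (λ i → ν n * t (toℕ i))       ≈⟨ sum-cong-≋ {suc n} term ⟩
        sum {suc n} (λ i → u (toℕ i) + v (toℕ i)) ≈⟨ ∑-distrib-+ {suc n} (λ i → u (toℕ i)) (λ i → v (toℕ i)) ⟩
        (θ f P.* g P.+ f P.* θ g) n               ∎
        where
        t u v : ℕ → Carrier
        t i = f i * g (n ℕ.∸ i)
        u i = θ f i * g (n ℕ.∸ i)
        v i = f i * θ g (n ℕ.∸ i)
        term : ∀ (i : Fin (suc n)) → ν n * t (toℕ i) ≈ u (toℕ i) + v (toℕ i)
        term i = let j = toℕ i in begin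
          ν n * t j                        ≡⟨ ≡.cong (λ m → ν m * t j) (ℕ.m+[n∸m]≡n (Fin.toℕ≤pred[n] i)) ⟨
          ν (j ℕ.+ (n ℕ.∸ j)) * t j        ≈⟨ *-congʳ (ν-+ j (n ℕ.∸ j)) ⟩
          (ν j + ν (n ℕ.∸ j)) * t j
            ≈⟨ solve 4 (λ a b c d → (a :+ b) :* (c :* d) := a :* c :* d :+ c :* (b :* d)) refl _ _ _ _ ⟩
          u j + v j                        ∎

      -- `θ f` and `θ g` have constant term 0. In `θ-*` at `suc n` the first product thus loses its
      -- first summand and the second product its last.
      D-* : ∀ f g → D (f P.* g) P.≈ D f P.* g P.+ f P.* D g
      D-* f g n = begin
        θ (f P.* g) (suc n)                          ≈⟨ θ-* f g (suc n) ⟩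
        (ν 0 * f 0 * g (suc n) + (D f P.* g) n) + (f P.* θ g) (suc n)
          ≈⟨ +-congˡ (conv-suc f (θ g) n) ⟩
        (ν 0 * f 0 * g (suc n) + (D f P.* g) n) + ((f P.* D g) n + f (suc n) * (ν 0 * g 0))
          ≈⟨ +-cong (+-congʳ (*-congʳ (*-congʳ ν-zero))) (+-congˡ (*-congˡ (*-congʳ ν-zero))) ⟩
        (0# * f 0 * g (suc n) + (D f P.* g) n) + ((f P.* D g) n + f (suc n) * (0# * g 0))
          ≈⟨ solve 6 (λ a b c d e f → (con 0 :* a :* b :+ c) :+ (d :+ e :* (con 0 :* f)) := c :+ d)
               refl _ _ _ _ _ _ ⟩
        (D f P.* g P.+ f P.* D g) n                  ∎

      -- Coefficient `n` of the equation expresses coefficient `suc n` of a solution through the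
      -- earlier ones, so strong induction applies.
      D-linear-unique : ∀ a g y z → D y P.≈ a P.* y P.+ g → D z P.≈ a P.* z P.+ g →
                        y 0 ≈ z 0 → y P.≈ z
      D-linear-unique a g y z Dy Dz y₀≈z₀ = <-rec (λ n → y n ≈ z n) step
        where
        step : ∀ n → (∀ {m} → m ℕ.< n → y m ≈ z m) → y n ≈ z n
        step zero    _   = y₀≈z₀
        step (suc n) rec = ν-cancel n (begin
          D y n                   ≈⟨ Dy n ⟩
          (a P.* y) n + g n
            ≈⟨ +-congʳ (sum-cong-≋ {suc n} (λ i → *-congˡ {a (toℕ i)} (rec (s≤s (ℕ.m∸n≤m n (toℕ i)))))) ⟩
          (a P.* z) n + g n       ≈⟨ Dz n ⟨
          D z n                   ∎)

    D≈0⇒≈1 : ∀ {f} → D f P.≈ P.0# → f 0 ≈ 1# → f P.≈ P.1#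
    D≈0⇒≈1 {f} Df f₀ = D-linear-unique P.0# P.0# f P.1#
      (λ n → trans (Df n) (0≈ f n)) (λ n → trans (zeroʳ _) (0≈ P.1# n)) f₀
      where
      0≈ : ∀ y n → 0# ≈ (P.0# P.* y P.+ P.0#) n
      0≈ y n = sym (trans (+-identityʳ _) (conv-zeroˡ y (λ _ → refl) n))

    private module S = CommutativeRing series-commutativeRing

    module _ where
      open import Relation.Binary.Reasoning.Setoid S.setoid
      open RingSolver S.commutativeSemiring using (solve; _:=_; _:+_; _:*_)

      inverse-solutions : ∀ {a b p q} → D p P.≈ a P.* p → D q P.≈ b P.* q → a P.+ b P.≈ P.0# →
                          (p P.* q) 0 ≈ 1# → p P.* q P.≈ P.1#
      inverse-solutions {a} {b} {p} {q} Dp Dq a+b≈0 = D≈0⇒≈1 (begin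
        D (p S.* q)                             ≈⟨ D-* p q ⟩
        D p S.* q S.+ p S.* D q                 ≈⟨ S.+-cong (S.*-congʳ {q} Dp) (S.*-congˡ {p} Dq) ⟩
        (a S.* p) S.* q S.+ p S.* (b S.* q)
          ≈⟨ solve 4 (λ a b p q → (a :* p) :* q :+ p :* (b :* q) := (a :+ b) :* (p :* q)) (λ _ → refl) a b p q ⟩
        (a S.+ b) S.* (p S.* q)                 ≈⟨ conv-zeroˡ (p S.* q) a+b≈0 ⟩
        S.0#                                    ∎)

      variation-of-constants : ∀ {a g p q y} → D p P.≈ a P.* p → p P.* q P.≈ P.1# → D y P.≈ q P.* g →
                               D (p P.* y) P.≈ a P.* (p P.* y) P.+ g
      variation-of-constants {a} {g} {p} {q} {y} Dp pq≈1 Dy = begin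
        D (p S.* y)                             ≈⟨ D-* p y ⟩
        D p S.* y S.+ p S.* D y                 ≈⟨ S.+-cong (S.*-congʳ {y} Dp) (S.*-congˡ {p} Dy) ⟩
        (a S.* p) S.* y S.+ p S.* (q S.* g)
          ≈⟨ solve 5 (λ a g p q y → (a :* p) :* y :+ p :* (q :* g) := a :* (p :* y) :+ (p :* q) :* g)
               (λ _ → refl) a g p q y ⟩
        a S.* (p S.* y) S.+ (p S.* q) S.* g
          ≈⟨ S.+-congˡ {a S.* (p S.* y)} (S.trans (S.*-congʳ {g} pq≈1) (S.*-identityˡ g)) ⟩
        a S.* (p S.* y) S.+ g                   ∎

-- Real numbers

∣p-q∣<ε : ∀ {p q} → p ≡ q → ∀ ε → 0ℚ ℚ.< ε → ∣ p ℚ.- q ∣ ℚ.< ε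
∣p-q∣<ε {p} ≡.refl ε 0<ε = ≡.subst (ℚ._< ε) (≡.cong ∣_∣ (≡.sym (ℚ.+-inverseʳ p))) 0<ε

≈ᴿ-pointwise : ∀ x y → (∀ n → approx x n ≡ approx y n) → x ≈ᴿ y
≈ᴿ-pointwise x y p ε 0<ε = 0 , λ n _ → ∣p-q∣<ε (p n) ε 0<ε

-- The Cauchy condition compares neighbouring approximations. This absorbs the index shift caused by
-- differentiating partial sums.
≈ᴿ-shift : ∀ x y → (∀ n → approx x (suc n) ≡ approx y n) → x ≈ᴿ y
≈ᴿ-shift x y p ε 0<ε = let k , h = cauchy x ε 0<ε in k , λ n k≤n →
  ≡.subst (λ z → ∣ approx x n ℚ.- z ∣ ℚ.< ε) (p n) (h n (suc n) k≤n (ℕ.m≤n⇒m≤1+n k≤n))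

≈ᴿ-sym : ∀ x y → x ≈ᴿ y → y ≈ᴿ x
≈ᴿ-sym x y p ε 0<ε = let k , h = p ε 0<ε in k , λ n k≤n →
  ≡.subst (ℚ._< ε) (∣-∣-comm (approx x n) (approx y n)) (h n k≤n)

∣+∣<ε : ∀ ε a b {c} → c ≡ a ℚ.+ b → ∣ a ∣ ℚ.< ½ ℚ.* ε → ∣ b ∣ ℚ.< ½ ℚ.* ε → ∣ c ∣ ℚ.< ε
∣+∣<ε ε a b ≡.refl a< b< = ℚ.≤-<-trans (ℚ.∣p+q∣≤∣p∣+∣q∣ a b)
  (≡.subst (∣ a ∣ ℚ.+ ∣ b ∣ ℚ.<_) (half+half ε) (ℚ.+-mono-< a< b<))

≈ᴿ-trans : ∀ x y z → x ≈ᴿ y → y ≈ᴿ z → x ≈ᴿ z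
≈ᴿ-trans x y z p q ε 0<ε =
  let k , h = p (½ ℚ.* ε) (half-pos 0<ε)
      l , i = q (½ ℚ.* ε) (half-pos 0<ε)
  in k ℕ.⊔ l , λ n kl≤n → ∣+∣<ε ε (approx x n ℚ.- approx y n) (approx y n ℚ.- approx z n)
    (sub-sub (approx x n) (approx z n) (approx y n))
    (h n (ℕ.m⊔n≤o⇒m≤o k l kl≤n)) (i n (ℕ.m⊔n≤o⇒n≤o k l kl≤n))

module R = RawRing ℝ-rawRing

+ᴿ-cong : ∀ x x′ y y′ → x ≈ᴿ x′ → y ≈ᴿ y′ → x R.+ y ≈ᴿ x′ R.+ y′
+ᴿ-cong x x′ y y′ p q ε 0<ε =
  let k , h = p (½ ℚ.* ε) (half-pos 0<ε)
      l , i = q (½ ℚ.* ε) (half-pos 0<ε)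
  in k ℕ.⊔ l , λ n kl≤n → ∣+∣<ε ε (approx x n ℚ.- approx x′ n) (approx y n ℚ.- approx y′ n)
    (+-sub (approx x n) (approx y n) (approx x′ n) (approx y′ n))
    (h n (ℕ.m⊔n≤o⇒m≤o k l kl≤n)) (i n (ℕ.m⊔n≤o⇒n≤o k l kl≤n))

-ᴿ-cong : ∀ x y → x ≈ᴿ y → R.- x ≈ᴿ R.- y
-ᴿ-cong x y p ε 0<ε = let k , h = p ε 0<ε in k , λ n k≤n →
  ≡.subst (ℚ._< ε) (≡.trans (∣-∣-comm (approx x n) (approx y n))
    (≡.cong ∣_∣ (sub-neg (approx x n) (approx y n)))) (h n k≤n)

*ᴿ-cong : ∀ x x′ y y′ → x ≈ᴿ x′ → y ≈ᴿ y′ → x R.* y ≈ᴿ x′ R.* y′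
*ᴿ-cong x x′ y y′ p q ε 0<ε =
  let A , A>0 , a , hA = bounded (approx x) (cauchy x)
      B , B>0 , b , hB = bounded (approx y′) (cauchy y′)
      α , 0<α , Aα = shrink A (½ ℚ.* ε) A>0 (half-pos 0<ε)
      β , 0<β , Bβ = shrink B (½ ℚ.* ε) B>0 (half-pos 0<ε)
      k , h = p β 0<β
      l , i = q α 0<α
  in (a ℕ.⊔ b) ℕ.⊔ (k ℕ.⊔ l) , λ n m≤n →
    let ab≤n = ℕ.m⊔n≤o⇒m≤o (a ℕ.⊔ b) (k ℕ.⊔ l) m≤n
        kl≤n = ℕ.m⊔n≤o⇒n≤o (a ℕ.⊔ b) (k ℕ.⊔ l) m≤n
    in *-close A B α β ε {{A>0}} {{B>0}} Aα Bβ (approx x n) (approx y n) (approx x′ n) (approx y′ n)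
         (hA n (ℕ.m⊔n≤o⇒m≤o a b ab≤n)) (hB n (ℕ.m⊔n≤o⇒n≤o a b ab≤n))
         (i n (ℕ.m⊔n≤o⇒n≤o k l kl≤n)) (h n (ℕ.m⊔n≤o⇒m≤o k l kl≤n))

ℝ-commutativeRing : CommutativeRing 0ℓ 0ℓ
ℝ-commutativeRing = record
  { Carrier = ℝ ; _≈_ = _≈ᴿ_ ; _+_ = R._+_ ; _*_ = R._*_ ; -_ = R.-_ ; 0# = R.0# ; 1# = R.1#
  ; isCommutativeRing = record
    { isRing = record
      { +-isAbelianGroup = record
        { isGroup = record
          { isMonoid = record
            { isSemigroup = record
              { isMagma = record
                { isEquivalence = record
                  { refl = λ {x} → ≈ᴿ-pointwise x x (λ _ → ≡.refl)
                  ; sym = λ {x} {y} → ≈ᴿ-sym x y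
                  ; trans = λ {x} {y} {z} → ≈ᴿ-trans x y z }
                ; ∙-cong = λ {x} {x′} {y} {y′} → +ᴿ-cong x x′ y y′ }
              ; assoc = λ x y z → ≈ᴿ-pointwise ((x R.+ y) R.+ z) (x R.+ (y R.+ z))
                  λ n → ℚ.+-assoc (approx x n) (approx y n) (approx z n) }
            ; identity = (λ x → ≈ᴿ-pointwise (R.0# R.+ x) x λ n → ℚ.+-identityˡ (approx x n))
                , λ x → ≈ᴿ-pointwise (x R.+ R.0#) x λ n → ℚ.+-identityʳ (approx x n) }
          ; inverse = (λ x → ≈ᴿ-pointwise (R.- x R.+ x) R.0# λ n → ℚ.+-inverseˡ (approx x n))
              , λ x → ≈ᴿ-pointwise (x R.+ R.- x) R.0# λ n → ℚ.+-inverseʳ (approx x n)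
          ; ⁻¹-cong = λ {x} {y} → -ᴿ-cong x y }
        ; comm = λ x y → ≈ᴿ-pointwise (x R.+ y) (y R.+ x) λ n → ℚ.+-comm (approx x n) (approx y n) }
      ; *-cong = λ {x} {x′} {y} {y′} → *ᴿ-cong x x′ y y′
      ; *-assoc = λ x y z → ≈ᴿ-pointwise ((x R.* y) R.* z) (x R.* (y R.* z))
          λ n → ℚ.*-assoc (approx x n) (approx y n) (approx z n)
      ; *-identity = (λ x → ≈ᴿ-pointwise (R.1# R.* x) x λ n → ℚ.*-identityˡ (approx x n))
          , λ x → ≈ᴿ-pointwise (x R.* R.1#) x λ n → ℚ.*-identityʳ (approx x n)
      ; distrib = (λ x y z → ≈ᴿ-pointwise (x R.* (y R.+ z)) (x R.* y R.+ x R.* z)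
            λ n → ℚ.*-distribˡ-+ (approx x n) (approx y n) (approx z n))
          , λ x y z → ≈ᴿ-pointwise ((y R.+ z) R.* x) (y R.* x R.+ z R.* x)
            λ n → ℚ.*-distribʳ-+ (approx x n) (approx y n) (approx z n) }
    ; *-comm = λ x y → ≈ᴿ-pointwise (x R.* y) (y R.* x) λ n → ℚ.*-comm (approx x n) (approx y n) } }

-- Integers and reciprocal factorials as rationals

/-≡ : ∀ a b c d .{{_ : ℕ.NonZero b}} .{{_ : ℕ.NonZero d}} →
      a ℕ.* d ≡ c ℕ.* b → ℤ.+ a ℚ./ b ≡ ℤ.+ c ℚ./ d
/-≡ a (suc b) c (suc d) h =
  ℚ.≤-antisym (/-≤ a b c d (ℕ.≤-reflexive h)) (/-≤ c d a b (ℕ.≤-reflexive (≡.sym h)))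

fromℕ : ℕ → ℚ
fromℕ n = ℤ.+ n ℚ./ 1

1/suc : ℕ → ℚ
1/suc n = ℤ.+ 1 ℚ./ suc n

fromℕ-+ : ∀ m n → fromℕ (m ℕ.+ n) ≡ fromℕ m ℚ.+ fromℕ n
fromℕ-+ m n = ℚ.toℚᵘ-injective (ℚᵘ.≃-trans (toℚᵘ-/ (m ℕ.+ n) 0) (ℚᵘ.≃-trans (ℚᵘ.*≡* eq)
  (ℚᵘ.≃-sym (ℚᵘ.≃-trans (ℚ.toℚᵘ-homo-+ (fromℕ m) (fromℕ n)) (ℚᵘ.+-cong (toℚᵘ-/ m 0) (toℚᵘ-/ n 0))))))
  where
  eq : ℤ.+ (m ℕ.+ n) ℤ.* ℤ.+ 1 ≡ (ℤ.+ m ℤ.* ℤ.+ 1 ℤ.+ ℤ.+ n ℤ.* ℤ.+ 1) ℤ.* ℤ.+ 1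
  eq = ≡.cong (ℤ._* ℤ.+ 1) (≡.trans (ℤ.pos-+ m n)
    (≡.cong₂ ℤ._+_ (≡.sym (ℤ.*-identityʳ (ℤ.+ m))) (≡.sym (ℤ.*-identityʳ (ℤ.+ n)))))

fromℕ*1/ : ∀ a b .{{_ : ℕ.NonZero b}} → fromℕ a ℚ.* (ℤ.+ 1 ℚ./ b) ≡ ℤ.+ a ℚ./ b
fromℕ*1/ a (suc b) = ≡.trans (/-* a 0 1 b)
  (/-≡ (a ℕ.* 1) (1 ℕ.* suc b) a (suc b)
    (≡.cong₂ ℕ._*_ (ℕ.*-identityʳ a) (≡.sym (ℕ.*-identityˡ (suc b)))))

fromℕ*1/suc : ∀ n → fromℕ (suc n) ℚ.* 1/suc n ≡ 1ℚ
fromℕ*1/suc n = ≡.trans (fromℕ*1/ (suc n) (suc n)) (/-≡ (suc n) (suc n) 1 1 (ℕ.*-comm (suc n) 1))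

fromℕ*1/! : ∀ n → fromℕ (suc n) ℚ.* 1/ suc n ! ≡ 1/ n !
fromℕ*1/! n = ≡.trans (fromℕ*1/ (suc n) (suc n !) {{suc n ℕ.!≢0}})
  (/-≡ (suc n) (suc n !) 1 (n !) {{suc n ℕ.!≢0}} {{n ℕ.!≢0}} (≡.sym (ℕ.*-identityˡ (suc n !))))

0≤1/! : ∀ n → 0ℚ ℚ.≤ 1/ n !
0≤1/! n = ℚ.nonNegative⁻¹ (1/ n !) {{ℚ.normalize-nonNeg 1 (n !) {{n ℕ.!≢0}}}}

module ℚ-series = FormalSeries ℚ.+-*-commutativeRing
module ℚ-calculus = ℚ-series.Calculus fromℕ ≡.refl (fromℕ-+ 1) 1/suc fromℕ*1/suc
-- Sealed, so that the type checker never unfolds the Cauchy proofs carried by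
-- the real numbers.
abstract
  sealed-ℝ : CommutativeRing 0ℓ 0ℓ
  sealed-ℝ = ℝ-commutativeRing

  ⟦_⟧ : ℝ → CommutativeRing.Carrier sealed-ℝ
  ⟦ x ⟧ = x

module 𝓡 = CommutativeRing sealed-ℝ

abstract
  ⟦⟧-cong : ∀ x y → x ≈ᴿ y → ⟦ x ⟧ 𝓡.≈ ⟦ y ⟧
  ⟦⟧-cong x y p = p

  ⟦⟧-injective : ∀ x y → ⟦ x ⟧ 𝓡.≈ ⟦ y ⟧ → x ≈ᴿ y
  ⟦⟧-injective x y p = p

  -- These are spelled out so that only approximations get compared, not Cauchy proofs.
  ⟦⟧-+ : ∀ x y → ⟦ x R.+ y ⟧ 𝓡.≈ ⟦ x ⟧ 𝓡.+ ⟦ y ⟧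
  ⟦⟧-+ x y ε 0<ε = 0 , λ n _ → ∣p-q∣<ε {approx x n ℚ.+ approx y n} ≡.refl ε 0<ε

  ⟦⟧-* : ∀ x y → ⟦ x R.* y ⟧ 𝓡.≈ ⟦ x ⟧ 𝓡.* ⟦ y ⟧
  ⟦⟧-* x y ε 0<ε = 0 , λ n _ → ∣p-q∣<ε {approx x n ℚ.* approx y n} ≡.refl ε 0<ε

  embed : ℚ → 𝓡.Carrier
  embed q = fromℚ q

  ⟦fromℚ⟧ : ∀ q → ⟦ fromℚ q ⟧ ≡ embed q
  ⟦fromℚ⟧ q = ≡.refl

  embed-0 : embed 0ℚ ≡ 𝓡.0#
  embed-0 = ≡.refl

  embed-1 : embed 1ℚ ≡ 𝓡.1#
  embed-1 = ≡.refl

  embed-+ : ∀ p q → embed (p ℚ.+ q) 𝓡.≈ embed p 𝓡.+ embed q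
  embed-+ p q ε 0<ε = 0 , λ n _ → ∣p-q∣<ε {p ℚ.+ q} ≡.refl ε 0<ε

  embed-* : ∀ p q → embed (p ℚ.* q) 𝓡.≈ embed p 𝓡.* embed q
  embed-* p q ε 0<ε = 0 , λ n _ → ∣p-q∣<ε {p ℚ.* q} ≡.refl ε 0<ε

⟦⟧-pointwise : ∀ x y → (∀ n → approx x n ≡ approx y n) → ⟦ x ⟧ 𝓡.≈ ⟦ y ⟧
⟦⟧-pointwise x y p = ⟦⟧-cong x y (≈ᴿ-pointwise x y p)

module ℝ-series = FormalSeries sealed-ℝ
module ℝ-calculus = ℝ-series.Calculus (embed ∘ fromℕ)
  (𝓡.reflexive embed-0)
  (λ n → 𝓡.trans (𝓡.reflexive (≡.cong embed (fromℕ-+ 1 n)))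
    (𝓡.trans (embed-+ 1ℚ (fromℕ n)) (𝓡.+-congʳ (𝓡.reflexive embed-1))))
  (embed ∘ 1/suc)
  (λ n → 𝓡.trans (𝓡.sym (embed-* (fromℕ (suc n)) (1/suc n)))
    (𝓡.trans (𝓡.reflexive (≡.cong embed (fromℕ*1/suc n))) (𝓡.reflexive embed-1)))

-- Exponentials of power series

module ℚS where
  open CommutativeRing ℚ-series.series-commutativeRing public
  open ℚ-series public using (_•_; tail; conv-•; conv-zeroˡ; conv-suc)
  open ℚ-calculus public using (D; D-cong; D-*; D-linear-unique; D≈0⇒≈1)
  open RingProperties ring public using (-‿distribʳ-*)
  open RingSolver commutativeSemiring public using (solve; _:=_; _:+_; _:*_; con)

module ℝS where
  open CommutativeRing ℝ-series.series-commutativeRing public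
  open ℝ-calculus public using (D; D-linear-unique; ν*[x*μ]; inverse-solutions; variation-of-constants)

open ℚ⟦X⟧ using (_^_)

D-eˣ : ℚS.D eˣ ℚS.≈ eˣ
D-eˣ = fromℕ*1/!

D-1 : ℚS.D ℚS.1# ℚS.≈ ℚS.0#
D-1 n = ℚ.*-zeroʳ (fromℕ (suc n))

D-‿ : ∀ f → ℚS.D (ℚS.- f) ℚS.≈ ℚS.- ℚS.D f
D-‿ f n = ≡.sym (ℚ.neg-distribʳ-* (fromℕ (suc n)) (f (suc n)))

*-• : ∀ f c g → f ℚS.* (c ℚS.• g) ℚS.≈ c ℚS.• (f ℚS.* g)
*-• f c g = begin
  f * (c • g)  ≈⟨ *-comm f (c • g) ⟩
  (c • g) * f  ≈⟨ conv-• c g f ⟩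
  c • (g * f)  ≈⟨ (λ n → ≡.cong (c ℚ.*_) (*-comm g f n)) ⟩
  c • (f * g)  ∎
  where
  open ℚS
  open import Relation.Binary.Reasoning.Setoid setoid

•-suc : ∀ m f → f ℚS.+ fromℕ m ℚS.• f ℚS.≈ fromℕ (suc m) ℚS.• f
•-suc m f n = begin
  f n ℚ.+ fromℕ m ℚ.* f n        ≡⟨ ≡.cong (ℚ._+ fromℕ m ℚ.* f n) (ℚ.*-identityˡ (f n)) ⟨
  1ℚ ℚ.* f n ℚ.+ fromℕ m ℚ.* f n ≡⟨ ℚ.*-distribʳ-+ (f n) 1ℚ (fromℕ m) ⟨
  (1ℚ ℚ.+ fromℕ m) ℚ.* f n       ≡⟨ ≡.cong (ℚ._* f n) (fromℕ-+ 1 m) ⟨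
  fromℕ (suc m) ℚ.* f n          ∎
  where open ≡.≡-Reasoning

-- The extra factor `f` avoids the exponent m - 1, so m = 0 is included; this statement and `D-^`
-- feed each other through the product rule.
*-D-^ : ∀ f m → f ℚS.* ℚS.D (f ^ m) ℚS.≈ fromℕ m ℚS.• (ℚS.D f ℚS.* (f ^ m))
D-^ : ∀ f m → ℚS.D (f ^ suc m) ℚS.≈ fromℕ (suc m) ℚS.• (ℚS.D f ℚS.* (f ^ m))

*-D-^ f zero    n = begin
  (f * D 1#) n                   ≡⟨ *-comm f (D 1#) n ⟩
  (D 1# * f) n                   ≡⟨ conv-zeroˡ f D-1 n ⟩
  0ℚ                             ≡⟨ ℚ.*-zeroˡ ((D f * 1#) n) ⟨
  0ℚ ℚ.* (D f * 1#) n            ∎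
  where
  open ℚS
  open ≡.≡-Reasoning
*-D-^ f (suc m) = begin
  f * D (f ^ suc m)                       ≈⟨ *-congˡ {f} (D-^ f m) ⟩
  f * (fromℕ (suc m) • (D f * (f ^ m)))   ≈⟨ *-• f (fromℕ (suc m)) (D f * (f ^ m)) ⟩
  fromℕ (suc m) • (f * (D f * (f ^ m)))
    ≈⟨ (λ n → ≡.cong (fromℕ (suc m) ℚ.*_)
         (solve 3 (λ a b c → a :* (b :* c) := b :* (a :* c)) (λ {n} _ → ≡.refl) f (D f) (f ^ m) n)) ⟩
  fromℕ (suc m) • (D f * (f ^ suc m))     ∎
  where
  open ℚS
  open import Relation.Binary.Reasoning.Setoid setoid

D-^ f m = begin
  D (f * (f ^ m))                              ≈⟨ D-* f (f ^ m) ⟩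
  D f * (f ^ m) + f * D (f ^ m)                ≈⟨ +-congˡ {D f * (f ^ m)} (*-D-^ f m) ⟩
  D f * (f ^ m) + fromℕ m • (D f * (f ^ m))    ≈⟨ •-suc m (D f * (f ^ m)) ⟩
  fromℕ (suc m) • (D f * (f ^ m))              ∎
  where
  open ℚS
  open import Relation.Binary.Reasoning.Setoid setoid

expₖ : ℚ⟦X⟧ → ℕ → ℚ⟦X⟧
expₖ f k n = exp-partial f n k

expₖ-suc : ∀ f k → expₖ f (suc k) ℚS.≈ expₖ f k ℚS.+ 1/ k ! ℚS.• (f ^ k)
expₖ-suc f k n = ≡.trans (∑-last k (λ m → (f ^ m) n ℚ.* 1/ m !))
  (≡.cong (exp-partial f n k ℚ.+_) (ℚ.*-comm ((f ^ k) n) (1/ k !)))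

D-+ : ∀ f g → ℚS.D (f ℚS.+ g) ℚS.≈ ℚS.D f ℚS.+ ℚS.D g
D-+ f g n = ℚ.*-distribˡ-+ (fromℕ (suc n)) (f (suc n)) (g (suc n))

-- The derivative of the m-th term of the exponential series is f′ times the term before it. The
-- identity is exact over ℚ, with the number of terms shifted by one.
D-expₖ : ∀ f k → ℚS.D (expₖ f (suc k)) ℚS.≈ ℚS.D f ℚS.* expₖ f k
D-expₖ f zero = begin
  D (expₖ f 1)        ≈⟨ D-cong {expₖ f 1} {1#} (λ n → ≡.trans (ℚ.+-identityʳ (1# n ℚ.* 1ℚ)) (ℚ.*-identityʳ (1# n))) ⟩
  D 1#                ≈⟨ D-1 ⟩
  0#                  ≈⟨ zeroʳ (D f) ⟨
  D f * expₖ f 0      ∎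
  where
  open ℚS
  open import Relation.Binary.Reasoning.Setoid setoid
D-expₖ f (suc k) = begin
  D (expₖ f (suc (suc k)))                                  ≈⟨ D-cong (expₖ-suc f (suc k)) ⟩
  D (expₖ f (suc k) + 1/ suc k ! • (f ^ suc k))
    ≈⟨ D-+ (expₖ f (suc k)) (1/ suc k ! • (f ^ suc k)) ⟩
  D (expₖ f (suc k)) + D (1/ suc k ! • (f ^ suc k))         ≈⟨ +-cong (D-expₖ f k) term ⟩
  D f * expₖ f k + 1/ k ! • (D f * (f ^ k))                 ≈⟨ +-congˡ {D f * expₖ f k} (*-• (D f) (1/ k !) (f ^ k)) ⟨
  D f * expₖ f k + D f * (1/ k ! • (f ^ k))                 ≈⟨ distribˡ (D f) (expₖ f k) (1/ k ! • (f ^ k)) ⟨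
  D f * (expₖ f k + 1/ k ! • (f ^ k))                       ≈⟨ *-congˡ {D f} (expₖ-suc f k) ⟨
  D f * expₖ f (suc k)                                      ∎
  where
  open ℚS
  term : D (1/ suc k ! • (f ^ suc k)) ≈ 1/ k ! • (D f * (f ^ k))
  term n = begin
    fromℕ (suc n) ℚ.* (1/ suc k ! ℚ.* (f ^ suc k) (suc n))
      ≡⟨ swap (fromℕ (suc n)) (1/ suc k !) ((f ^ suc k) (suc n)) ⟩
    1/ suc k ! ℚ.* D (f ^ suc k) n                           ≡⟨ ≡.cong (1/ suc k ! ℚ.*_) (D-^ f k n) ⟩
    1/ suc k ! ℚ.* (fromℕ (suc k) ℚ.* (D f * (f ^ k)) n)
      ≡⟨ swap′ (1/ suc k !) (fromℕ (suc k)) ((D f * (f ^ k)) n) ⟩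
    (fromℕ (suc k) ℚ.* 1/ suc k !) ℚ.* (D f * (f ^ k)) n     ≡⟨ ≡.cong (ℚ._* (D f * (f ^ k)) n) (fromℕ*1/! k) ⟩
    1/ k ! ℚ.* (D f * (f ^ k)) n                             ∎
    where
    open ≡.≡-Reasoning
    open +-*-Solver renaming (solve to solveℚ; _:*_ to _⊛_; _:=_ to _⊜_)
    swap : ∀ a b c → a ℚ.* (b ℚ.* c) ≡ b ℚ.* (a ℚ.* c)
    swap = solveℚ 3 (λ a b c → a ⊛ (b ⊛ c) ⊜ b ⊛ (a ⊛ c)) ≡.refl
    swap′ : ∀ a b c → a ℚ.* (b ℚ.* c) ≡ (b ℚ.* a) ℚ.* c
    swap′ = solveℚ 3 (λ a b c → a ⊛ (b ⊛ c) ⊜ (b ⊛ a) ⊛ c) ≡.refl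
  open import Relation.Binary.Reasoning.Setoid setoid

-- The terms of the numerical series for the exponential of `f 0`; read as a power series in x this
-- is the exponential of `f 0` times x.
constants : ℚ⟦X⟧ → ℚ⟦X⟧
constants f m = (f ^ m) 0 ℚ.* 1/ m !

D-constants : ∀ f → ℚS.D (constants f) ℚS.≈ f 0 ℚS.• constants f
D-constants f m = begin
  fromℕ (suc m) ℚ.* ((f 0 ℚ.* (f ^ m) 0 ℚ.+ 0ℚ) ℚ.* 1/ suc m !)
    ≡⟨ lemma (fromℕ (suc m)) (f 0) ((f ^ m) 0) (1/ suc m !) ⟩
  f 0 ℚ.* ((f ^ m) 0 ℚ.* (fromℕ (suc m) ℚ.* 1/ suc m !))
    ≡⟨ ≡.cong (λ z → f 0 ℚ.* ((f ^ m) 0 ℚ.* z)) (fromℕ*1/! m) ⟩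
  f 0 ℚ.* ((f ^ m) 0 ℚ.* 1/ m !)  ∎
  where
  open ≡.≡-Reasoning
  open +-*-Solver
  lemma : ∀ a b c d → a ℚ.* ((b ℚ.* c ℚ.+ 0ℚ) ℚ.* d) ≡ b ℚ.* (c ℚ.* (a ℚ.* d))
  lemma = solve 4 (λ a b c d → a :* ((b :* c :+ con 0ℚ) :* d) := b :* (c :* (a :* d))) ≡.refl

-- The geometric series 1/(1 - x): convolving with it takes partial sums.
geo : ℚ⟦X⟧
geo _ = 1ℚ

partial-sums : ∀ f n → (constants f ℚS.* geo) n ≡ exp-partial f 0 (suc n)
partial-sums f n = sum-cong-≋ {suc n} (λ i → ℚ.*-identityʳ (constants f (toℕ i)))
  where open SemiringSum (CommutativeRing.semiring ℚ.+-*-commutativeRing)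

eˣ≈constants : eˣ ℚS.≈ constants eˣ
eˣ≈constants n = ≡.sym (≡.trans (≡.cong (ℚ._* 1/ n !) (1^ n)) (ℚ.*-identityˡ (1/ n !)))
  where
  1^ : ∀ m → (eˣ ^ m) 0 ≡ 1ℚ
  1^ zero    = ≡.refl
  1^ (suc m) = ≡.trans (ℚ.+-identityʳ (1ℚ ℚ.* (eˣ ^ m) 0)) (≡.trans (ℚ.*-identityˡ ((eˣ ^ m) 0)) (1^ m))

-- The constant term of -eˣ is -1, so the coefficients are (-1)ⁿ/n!, the terms of the numerical
-- series for e⁻¹.
e⁻ˣ : ℚ⟦X⟧
e⁻ˣ = constants (ℚS.- eˣ)

D-e⁻ˣ : ℚS.D e⁻ˣ ℚS.≈ ℚS.- e⁻ˣ
D-e⁻ˣ n = ≡.trans (D-constants (ℚS.- eˣ) n) (≡.trans (≡.sym (ℚ.neg-distribˡ-* 1ℚ (e⁻ˣ n)))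
  (≡.cong ℚ.-_ (ℚ.*-identityˡ (e⁻ˣ n))))

eˣ*e⁻ˣ≈1 : eˣ ℚS.* e⁻ˣ ℚS.≈ ℚS.1#
eˣ*e⁻ˣ≈1 = D≈0⇒≈1 (begin
  D (eˣ * e⁻ˣ)               ≈⟨ D-* eˣ e⁻ˣ ⟩
  D eˣ * e⁻ˣ + eˣ * D e⁻ˣ    ≈⟨ +-cong (*-congʳ {e⁻ˣ} D-eˣ) (*-congˡ {eˣ} D-e⁻ˣ) ⟩
  eˣ * e⁻ˣ + eˣ * - e⁻ˣ      ≈⟨ +-congˡ {eˣ * e⁻ˣ} (-‿distribʳ-* eˣ e⁻ˣ) ⟨
  eˣ * e⁻ˣ - eˣ * e⁻ˣ        ≈⟨ -‿inverseʳ (eˣ * e⁻ˣ) ⟩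
  0#                         ∎) ≡.refl
  where
  open ℚS
  open import Relation.Binary.Reasoning.Setoid setoid

-- Both sides are e²ˣ, since eˣ + eˣ has constant term 2. In this form the coefficients 2ⁿ/n! are
-- terms of a convergent exponential series and tend to 0 by `constants→0`.
eˣ*eˣ≈ : eˣ ℚS.* eˣ ℚS.≈ constants (eˣ ℚS.+ eˣ)
eˣ*eˣ≈ = D-linear-unique (1# + 1#) 0# (eˣ * eˣ) (constants (eˣ + eˣ)) (begin
  D (eˣ * eˣ)                       ≈⟨ D-* eˣ eˣ ⟩
  D eˣ * eˣ + eˣ * D eˣ             ≈⟨ +-cong (*-congʳ {eˣ} D-eˣ) (*-congˡ {eˣ} D-eˣ) ⟩
  eˣ * eˣ + eˣ * eˣ                 ≈⟨ double (eˣ * eˣ) ⟩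
  (1# + 1#) * (eˣ * eˣ) + 0#        ∎) (begin
  D (constants (eˣ + eˣ))           ≈⟨ D-constants (eˣ + eˣ) ⟩
  (1ℚ ℚ.+ 1ℚ) • constants (eˣ + eˣ)
    ≈⟨ (λ n → ≡.trans (ℚ.*-distribʳ-+ (constants (eˣ + eˣ) n) 1ℚ 1ℚ)
         (≡.cong₂ ℚ._+_ (ℚ.*-identityˡ (constants (eˣ + eˣ) n)) (ℚ.*-identityˡ (constants (eˣ + eˣ) n)))) ⟩
  constants (eˣ + eˣ) + constants (eˣ + eˣ) ≈⟨ double (constants (eˣ + eˣ)) ⟩
  (1# + 1#) * constants (eˣ + eˣ) + 0# ∎) ≡.refl
  where
  open ℚS
  open import Relation.Binary.Reasoning.Setoid setoid
  double : ∀ f → f + f ≈ (1# + 1#) * f + 0#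
  double = solve 1 (λ f → f :+ f := (con 1 :+ con 1) :* f :+ con 0) (λ _ → ≡.refl)

∣e⁻ˣ∣≤ : ∀ n → ∣ e⁻ˣ n ∣ ℚ.≤ 1/ n !
∣e⁻ˣ∣≤ n = ℚ.≤-reflexive (begin
  ∣ ((ℚS.- eˣ) ^ n) 0 ℚ.* 1/ n ! ∣        ≡⟨ ℚ.∣p*q∣≡∣p∣*∣q∣ (((ℚS.- eˣ) ^ n) 0) (1/ n !) ⟩
  ∣ ((ℚS.- eˣ) ^ n) 0 ∣ ℚ.* ∣ 1/ n ! ∣    ≡⟨ ≡.cong₂ ℚ._*_ (∣-1^∣ n) (ℚ.0≤p⇒∣p∣≡p (0≤1/! n)) ⟩
  1ℚ ℚ.* 1/ n !                           ≡⟨ ℚ.*-identityˡ (1/ n !) ⟩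
  1/ n !                                  ∎)
  where
  open ≡.≡-Reasoning
  ∣-1^∣ : ∀ m → ∣ ((ℚS.- eˣ) ^ m) 0 ∣ ≡ 1ℚ
  ∣-1^∣ zero    = ≡.refl
  ∣-1^∣ (suc m) = let p = ((ℚS.- eˣ) ^ m) 0 in begin
    ∣ ℚ.- 1ℚ ℚ.* p ℚ.+ 0ℚ ∣   ≡⟨ ≡.cong ∣_∣ (ℚ.+-identityʳ (ℚ.- 1ℚ ℚ.* p)) ⟩
    ∣ ℚ.- 1ℚ ℚ.* p ∣          ≡⟨ ℚ.∣p*q∣≡∣p∣*∣q∣ (ℚ.- 1ℚ) p ⟩
    1ℚ ℚ.* ∣ p ∣              ≡⟨ ℚ.*-identityˡ ∣ p ∣ ⟩
    ∣ p ∣                     ≡⟨ ∣-1^∣ m ⟩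
    1ℚ                        ∎

2ℚ : ℚ
2ℚ = fromℕ 2

-- From 2 ≤ m + 2 it follows that 2/(m+2)! ≤ 1/(m+1)!. This is why the constant 2 survives the
-- induction in `e⁻ˣ-tail`.
2/!-step : ∀ m → 2ℚ ℚ.* 1/ suc (suc m) ! ℚ.+ 1/ suc m ! ℚ.≤ 2ℚ ℚ.* 1/ suc m !
2/!-step m = begin
  2ℚ ℚ.* 1/ suc (suc m) ! ℚ.+ 1/ suc m !
    ≤⟨ ℚ.+-monoˡ-≤ (1/ suc m !) (ℚ.*-monoʳ-≤-nonNeg (1/ suc (suc m) !) {{ℚ.nonNegative (0≤1/! (suc (suc m)))}}
         (/-≤ 2 0 (suc (suc m)) 0 (ℕ.*-monoˡ-≤ 1 (s≤s (s≤s (z≤n {m}))))) ) ⟩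
  fromℕ (suc (suc m)) ℚ.* 1/ suc (suc m) ! ℚ.+ 1/ suc m !
    ≡⟨ ≡.cong (ℚ._+ 1/ suc m !) (fromℕ*1/! (suc m)) ⟩
  1/ suc m ! ℚ.+ 1/ suc m !
    ≡⟨ solve 1 (λ a → a :+ a := con 2ℚ :* a) ≡.refl (1/ suc m !) ⟩
  2ℚ ℚ.* 1/ suc m !  ∎
  where
  open ℚ.≤-Reasoning
  open +-*-Solver

-- `B m` is the sum for e⁻¹ up to index `m`, so the difference is at most 1/(m+1)! + 1/(m+2)! and so
-- on. The first of these terms is peeled off, and the induction hypothesis at `suc m` bounds the
-- rest.
e⁻ˣ-tail : ∀ d m → let B = e⁻ˣ ℚS.* geo in ∣ B (d ℕ.+ m) ℚ.- B m ∣ ℚ.≤ 2ℚ ℚ.* 1/ suc m !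
e⁻ˣ-tail zero    m = begin
  ∣ B m ℚ.- B m ∣                    ≡⟨ ≡.cong ∣_∣ (ℚ.+-inverseʳ (B m)) ⟩
  0ℚ                                 ≡⟨ ℚ.*-zeroʳ 2ℚ ⟨
  2ℚ ℚ.* 0ℚ                          ≤⟨ ℚ.*-monoˡ-≤-nonNeg 2ℚ (0≤1/! (suc m)) ⟩
  2ℚ ℚ.* 1/ suc m !                  ∎
  where
  open ℚ.≤-Reasoning
  B = e⁻ˣ ℚS.* geo
e⁻ˣ-tail (suc d) m = begin
  ∣ B (suc d ℕ.+ m) ℚ.- B m ∣
    ≡⟨ ≡.cong (λ i → ∣ B i ℚ.- B m ∣) (ℕ.+-suc d m) ⟨
  ∣ B (d ℕ.+ suc m) ℚ.- B m ∣
    ≡⟨ ≡.cong ∣_∣ (sub-sub (B (d ℕ.+ suc m)) (B m) (B (suc m))) ⟩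
  ∣ (B (d ℕ.+ suc m) ℚ.- B (suc m)) ℚ.+ (B (suc m) ℚ.- B m) ∣
    ≤⟨ ℚ.∣p+q∣≤∣p∣+∣q∣ (B (d ℕ.+ suc m) ℚ.- B (suc m)) (B (suc m) ℚ.- B m) ⟩
  ∣ B (d ℕ.+ suc m) ℚ.- B (suc m) ∣ ℚ.+ ∣ B (suc m) ℚ.- B m ∣
    ≡⟨ ≡.cong (λ z → ∣ B (d ℕ.+ suc m) ℚ.- B (suc m) ∣ ℚ.+ ∣ z ℚ.- B m ∣) (ℚS.conv-suc e⁻ˣ geo m) ⟩
  ∣ B (d ℕ.+ suc m) ℚ.- B (suc m) ∣ ℚ.+ ∣ (B m ℚ.+ e⁻ˣ (suc m) ℚ.* 1ℚ) ℚ.- B m ∣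
    ≡⟨ ≡.cong (λ z → ∣ B (d ℕ.+ suc m) ℚ.- B (suc m) ∣ ℚ.+ ∣ z ∣)
         (≡.trans (add-sub (B m) (e⁻ˣ (suc m) ℚ.* 1ℚ)) (ℚ.*-identityʳ (e⁻ˣ (suc m)))) ⟩
  ∣ B (d ℕ.+ suc m) ℚ.- B (suc m) ∣ ℚ.+ ∣ e⁻ˣ (suc m) ∣
    ≤⟨ ℚ.+-mono-≤ (e⁻ˣ-tail d (suc m)) (∣e⁻ˣ∣≤ (suc m)) ⟩
  2ℚ ℚ.* 1/ suc (suc m) ! ℚ.+ 1/ suc m !  ≤⟨ 2/!-step m ⟩
  2ℚ ℚ.* 1/ suc m !                  ∎
  where
  open ℚ.≤-Reasoning
  B = e⁻ˣ ℚS.* geo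

∑-≤ : ∀ n (a b : ℕ → ℚ) → (∀ i → i ℕ.< n → a i ℚ.≤ b i) →
      ∑ ℚ.+-*-rawRing n a ℚ.≤ ∑ ℚ.+-*-rawRing n b
∑-≤ zero    a b h = ℚ.≤-refl
∑-≤ (suc n) a b h = ℚ.+-mono-≤ (h 0 (s≤s z≤n)) (∑-≤ n (a ∘ suc) (b ∘ suc) (λ i i<n → h (suc i) (s≤s i<n)))

∣∑∣≤∑∣∣ : ∀ n (a : ℕ → ℚ) → ∣ ∑ ℚ.+-*-rawRing n a ∣ ℚ.≤ ∑ ℚ.+-*-rawRing n (∣_∣ ∘ a)
∣∑∣≤∑∣∣ zero    a = ℚ.≤-refl
∣∑∣≤∑∣∣ (suc n) a = ℚ.≤-trans (ℚ.∣p+q∣≤∣p∣+∣q∣ (a 0) (∑ ℚ.+-*-rawRing n (a ∘ suc)))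
  (ℚ.+-monoʳ-≤ ∣ a 0 ∣ (∣∑∣≤∑∣∣ n (a ∘ suc)))

-- The equation `exp f 0` times `exp g 0` equals 1, spelled out on approximations; `+ 0ℚ` is the
-- empty rest of the sum in the constant coefficient of a product.
ProductOfValuesAt0→1 : ℚ⟦X⟧ → ℚ⟦X⟧ → Set
ProductOfValuesAt0→1 f g = ∀ ε → 0ℚ ℚ.< ε → ∃ λ k → ∀ n → k ℕ.≤ n →
  ∣ (exp-partial f 0 n ℚ.* exp-partial g 0 n ℚ.+ 0ℚ) ℚ.- 1ℚ ∣ ℚ.< ε

-- Since eˣ · e⁻ˣ = 1, coefficient `n` of eˣ · B is the coefficient 1 of `geo`. So the error is the
-- sum of (1/i!)(B n - B (n-i)) over i ≤ n, and `e⁻ˣ-tail` bounds the i-th summand by 2/(i!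
-- (n-i+1)!). These bounds are twice the summands of coefficient n+1 of eˣ · eˣ, except for its last
-- one, which is nonnegative.
partial-product : ∀ n → let A = eˣ ℚS.* geo ; B = e⁻ˣ ℚS.* geo in
                  ∣ A n ℚ.* B n ℚ.- 1ℚ ∣ ℚ.≤ 2ℚ ℚ.* constants (eˣ ℚS.+ eˣ) (suc n)
partial-product n = begin
  ∣ A n ℚ.* B n ℚ.- 1ℚ ∣
    ≡⟨ ≡.cong (λ z → ∣ A n ℚ.* B n ℚ.- z ∣) (≡.sym eˣ*B≡1) ⟩
  ∣ A n ℚ.* B n ℚ.- (eˣ ℚS.* B) n ∣
    ≡⟨ ≡.cong ∣_∣ difference ⟩
  ∣ ∑ ℚ.+-*-rawRing (suc n) (λ i → eˣ i ℚ.* (B n ℚ.- B (n ℕ.∸ i))) ∣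
    ≤⟨ ∣∑∣≤∑∣∣ (suc n) (λ i → eˣ i ℚ.* (B n ℚ.- B (n ℕ.∸ i))) ⟩
  ∑ ℚ.+-*-rawRing (suc n) (λ i → ∣ eˣ i ℚ.* (B n ℚ.- B (n ℕ.∸ i)) ∣)
    ≤⟨ ∑-≤ (suc n) (λ i → ∣ eˣ i ℚ.* (B n ℚ.- B (n ℕ.∸ i)) ∣)
         (λ i → 2ℚ ℚ.* (eˣ i ℚ.* ℚS.tail eˣ (n ℕ.∸ i))) term ⟩
  ∑ ℚ.+-*-rawRing (suc n) (λ i → 2ℚ ℚ.* (eˣ i ℚ.* ℚS.tail eˣ (n ℕ.∸ i)))
    ≡⟨ *-distribˡ-sum {suc n} 2ℚ (λ i → eˣ (toℕ i) ℚ.* ℚS.tail eˣ (n ℕ.∸ toℕ i)) ⟨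
  2ℚ ℚ.* (eˣ ℚS.* ℚS.tail eˣ) n
    ≤⟨ ℚ.*-monoˡ-≤-nonNeg 2ℚ (≡.subst₂ ℚ._≤_ (ℚ.+-identityʳ ((eˣ ℚS.* ℚS.tail eˣ) n))
         (≡.sym (ℚS.conv-suc eˣ eˣ n)) (ℚ.+-monoʳ-≤ ((eˣ ℚS.* ℚS.tail eˣ) n) 0≤)) ⟩
  2ℚ ℚ.* (eˣ ℚS.* eˣ) (suc n)
    ≡⟨ ≡.cong (2ℚ ℚ.*_) (eˣ*eˣ≈ (suc n)) ⟩
  2ℚ ℚ.* constants (eˣ ℚS.+ eˣ) (suc n) ∎
  where
  open ℚ.≤-Reasoning
  open SemiringSum (CommutativeRing.semiring ℚ.+-*-commutativeRing)
    using (*-distribˡ-sum; *-distribʳ-sum; sum-cong-≋; ∑-distrib-+; sum)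
  A B : ℚ⟦X⟧
  A = eˣ ℚS.* geo
  B = e⁻ˣ ℚS.* geo

  eˣ*B≡1 : (eˣ ℚS.* B) n ≡ 1ℚ
  eˣ*B≡1 = ≡.trans (≡.sym (ℚS.*-assoc eˣ e⁻ˣ geo n))
    (≡.trans (ℚS.*-congʳ {geo} eˣ*e⁻ˣ≈1 n) (ℚS.*-identityˡ geo n))

  difference : A n ℚ.* B n ℚ.- (eˣ ℚS.* B) n ≡
               ∑ ℚ.+-*-rawRing (suc n) (λ i → eˣ i ℚ.* (B n ℚ.- B (n ℕ.∸ i)))
  difference = ≡.trans (≡.cong (ℚ._- (eˣ ℚS.* B) n) An*Bn)
    (≡.trans (≡.cong (ℚ._- (eˣ ℚS.* B) n) (∑-distrib-+ {suc n} x y)) (add-sub′ (sum {suc n} x) (sum {suc n} y)))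
    where
    x y : Fin (suc n) → ℚ
    x i = eˣ (toℕ i) ℚ.* (B n ℚ.- B (n ℕ.∸ toℕ i))
    y i = eˣ (toℕ i) ℚ.* B (n ℕ.∸ toℕ i)
    add-sub′ : ∀ p q → (p ℚ.+ q) ℚ.- q ≡ p
    add-sub′ p q = ≡.trans (≡.cong (ℚ._- q) (ℚ.+-comm p q)) (add-sub q p)
    An*Bn : A n ℚ.* B n ≡ sum {suc n} (λ i → x i ℚ.+ y i)
    An*Bn = ≡.trans (*-distribʳ-sum {suc n} (B n) (λ i → eˣ (toℕ i) ℚ.* 1ℚ))
      (sum-cong-≋ {suc n} (λ i → lemma (eˣ (toℕ i)) (B n) (B (n ℕ.∸ toℕ i))))
      where
      open +-*-Solver
      lemma : ∀ a b c → (a ℚ.* 1ℚ) ℚ.* b ≡ a ℚ.* (b ℚ.- c) ℚ.+ a ℚ.* c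
      lemma = solve 3 (λ a b c → (a :* con 1ℚ) :* b := a :* (b :- c) :+ a :* c) ≡.refl

  term : ∀ i → i ℕ.< suc n →
         ∣ eˣ i ℚ.* (B n ℚ.- B (n ℕ.∸ i)) ∣ ℚ.≤ 2ℚ ℚ.* (eˣ i ℚ.* ℚS.tail eˣ (n ℕ.∸ i))
  term i (s≤s i≤n) = begin
    ∣ eˣ i ℚ.* (B n ℚ.- B (n ℕ.∸ i)) ∣
      ≡⟨ ℚ.∣p*q∣≡∣p∣*∣q∣ (eˣ i) (B n ℚ.- B (n ℕ.∸ i)) ⟩
    ∣ eˣ i ∣ ℚ.* ∣ B n ℚ.- B (n ℕ.∸ i) ∣
      ≡⟨ ≡.cong₂ (λ p j → p ℚ.* ∣ B j ℚ.- B (n ℕ.∸ i) ∣) (ℚ.0≤p⇒∣p∣≡p (0≤1/! i))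
           (≡.sym (ℕ.m+[n∸m]≡n i≤n)) ⟩
    eˣ i ℚ.* ∣ B (i ℕ.+ (n ℕ.∸ i)) ℚ.- B (n ℕ.∸ i) ∣
      ≤⟨ ℚ.*-monoˡ-≤-nonNeg (eˣ i) {{ℚ.nonNegative (0≤1/! i)}} (e⁻ˣ-tail i (n ℕ.∸ i)) ⟩
    eˣ i ℚ.* (2ℚ ℚ.* 1/ suc (n ℕ.∸ i) !)
      ≡⟨ swap (eˣ i) 2ℚ (1/ suc (n ℕ.∸ i) !) ⟩
    2ℚ ℚ.* (eˣ i ℚ.* 1/ suc (n ℕ.∸ i) !) ∎
    where
    open +-*-Solver
    swap : ∀ a b c → a ℚ.* (b ℚ.* c) ≡ b ℚ.* (a ℚ.* c)
    swap = solve 3 (λ a b c → a :* (b :* c) := b :* (a :* c)) ≡.refl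

  0≤ : 0ℚ ℚ.≤ eˣ (suc n) ℚ.* eˣ 0
  0≤ = ≡.subst (0ℚ ℚ.≤_) (≡.sym (ℚ.*-identityʳ (eˣ (suc n)))) (0≤1/! (suc n))

-- Each term is the difference of two consecutive partial sums, which form a Cauchy sequence.
constants→0 : ∀ f ε → 0ℚ ℚ.< ε → ∃ λ k → ∀ n → k ℕ.≤ n → ∣ constants f n ∣ ℚ.< ε
constants→0 f ε 0<ε = let k , h = exp-cauchy f 0 ε 0<ε in k , λ n k≤n →
  ≡.subst (λ z → ∣ z ∣ ℚ.< ε)
    (≡.trans (≡.cong (ℚ._- exp-partial f 0 n) (∑-last n (constants f)))
      (add-sub (exp-partial f 0 n) (constants f n)))
    (h (suc n) n (ℕ.m≤n⇒m≤1+n k≤n) k≤n)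

e*e⁻¹→1 : ProductOfValuesAt0→1 eˣ (ℚS.- eˣ)
e*e⁻¹→1 ε 0<ε =
  -- Half of ε makes up for the factor 2 in `partial-product`.
  let k , h = constants→0 (eˣ ℚS.+ eˣ) (½ ℚ.* ε) (half-pos 0<ε)
  in suc k , close k h
  where
  open ℚ.≤-Reasoning
  close : ∀ k → (∀ n → k ℕ.≤ n → ∣ constants (eˣ ℚS.+ eˣ) n ∣ ℚ.< ½ ℚ.* ε) → ∀ n → suc k ℕ.≤ n →
          ∣ (exp-partial eˣ 0 n ℚ.* exp-partial (ℚS.- eˣ) 0 n ℚ.+ 0ℚ) ℚ.- 1ℚ ∣ ℚ.< ε
  close k h (suc n) (s≤s k≤n) = begin-strict
    ∣ (exp-partial eˣ 0 (suc n) ℚ.* exp-partial (ℚS.- eˣ) 0 (suc n) ℚ.+ 0ℚ) ℚ.- 1ℚ ∣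
      ≡⟨ ≡.cong (λ z → ∣ z ℚ.- 1ℚ ∣)
           (ℚ.+-identityʳ (exp-partial eˣ 0 (suc n) ℚ.* exp-partial (ℚS.- eˣ) 0 (suc n))) ⟩
    ∣ exp-partial eˣ 0 (suc n) ℚ.* exp-partial (ℚS.- eˣ) 0 (suc n) ℚ.- 1ℚ ∣
      ≡⟨ ≡.cong₂ (λ p q → ∣ p ℚ.* q ℚ.- 1ℚ ∣)
           (≡.trans (ℚS.*-congʳ {geo} eˣ≈constants n) (partial-sums eˣ n)) (partial-sums (ℚS.- eˣ) n) ⟨
    ∣ (eˣ ℚS.* geo) n ℚ.* (e⁻ˣ ℚS.* geo) n ℚ.- 1ℚ ∣
      ≤⟨ partial-product n ⟩
    2ℚ ℚ.* c
      ≤⟨ ℚ.*-monoˡ-≤-nonNeg 2ℚ (p≤∣p∣ c) ⟩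
    2ℚ ℚ.* ∣ c ∣
      <⟨ ℚ.*-monoʳ-<-pos 2ℚ (h (suc n) (ℕ.m≤n⇒m≤1+n k≤n)) ⟩
    2ℚ ℚ.* (½ ℚ.* ε)
      ≡⟨ ≡.trans (≡.sym (ℚ.*-assoc 2ℚ ½ ε)) (ℚ.*-identityˡ ε) ⟩
    ε ∎
    where
    c : ℚ
    c = constants (eˣ ℚS.+ eˣ) (suc n)
    p≤∣p∣ : ∀ p → p ℚ.≤ ∣ p ∣
    p≤∣p∣ p with ℚ.≤-total 0ℚ p
    ... | inj₁ 0≤p = ℚ.≤-reflexive (≡.sym (ℚ.0≤p⇒∣p∣≡p 0≤p))
    ... | inj₂ p≤0 = ℚ.≤-trans p≤0 (ℚ.0≤∣p∣ p)

-- Transfer from approximations to real power series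

at : ℕ → ℝ⟦X⟧ → ℚ⟦X⟧
at k f n = approx (f n) k

at-∑ : ∀ k n f → approx (∑ ℝ-rawRing n f) k ≡ ∑ ℚ.+-*-rawRing n (λ i → approx (f i) k)
at-∑ k zero    f = ≡.refl
at-∑ k (suc n) f = ≡.cong (approx (f 0) k ℚ.+_) (at-∑ k n (f ∘ suc))

at-* : ∀ k f g → at k (f ℝ⟦X⟧.* g) ℚS.≈ at k f ℚS.* at k g
at-* k f g n = at-∑ k (suc n) (λ i → f i R.* g (n ℕ.∸ i))

⟦_⟧ₛ : ℝ⟦X⟧ → ℝS.Carrier
⟦ f ⟧ₛ n = ⟦ f n ⟧

⟦ι_⟧ₛ : ℚ⟦X⟧ → ℝS.Carrier
⟦ι f ⟧ₛ n = embed (f n)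

⟦⟧-∑ : ∀ n f → ⟦ ∑ ℝ-rawRing n f ⟧ 𝓡.≈ ∑ 𝓡.rawRing n (⟦_⟧ ∘ f)
⟦⟧-∑ zero    f = 𝓡.reflexive (≡.trans (⟦fromℚ⟧ 0ℚ) embed-0)
⟦⟧-∑ (suc n) f = 𝓡.trans (⟦⟧-pointwise (∑ ℝ-rawRing (suc n) f) (f 0 R.+ ∑ ℝ-rawRing n (f ∘ suc)) (λ _ → ≡.refl))
  (𝓡.trans (⟦⟧-+ (f 0) (∑ ℝ-rawRing n (f ∘ suc))) (𝓡.+-congˡ (⟦⟧-∑ n (f ∘ suc))))

⟦⟧ₛ-* : ∀ f g → ⟦ f ℝ⟦X⟧.* g ⟧ₛ ℝS.≈ ⟦ f ⟧ₛ ℝS.* ⟦ g ⟧ₛ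
⟦⟧ₛ-* f g n = 𝓡.trans
  (𝓡.trans (⟦⟧-pointwise ((f ℝ⟦X⟧.* g) n) (∑ ℝ-rawRing (suc n) (λ i → f i R.* g (n ℕ.∸ i))) (λ _ → ≡.refl))
    (⟦⟧-∑ (suc n) (λ i → f i R.* g (n ℕ.∸ i))))
  (SemiringSum.sum-cong-≋ 𝓡.semiring {suc n} (λ i → ⟦⟧-* (f (toℕ i)) (g (n ℕ.∸ toℕ i))))

⟦ι⟧ : ∀ f → ⟦ ι f ⟧ₛ ℝS.≈ ⟦ι f ⟧ₛ
⟦ι⟧ f n = 𝓡.reflexive (⟦fromℚ⟧ (f n))

ι-* : ∀ f g → ⟦ι f ℚS.* g ⟧ₛ ℝS.≈ ⟦ι f ⟧ₛ ℝS.* ⟦ι g ⟧ₛ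
ι-* f g n = 𝓡.trans (𝓡.trans (𝓡.reflexive (≡.sym (⟦fromℚ⟧ ((f ℚS.* g) n)))) (⟦⟧-cong (ι (f ℚS.* g) n) ((ι f ℝ⟦X⟧.* ι g) n)
    (≈ᴿ-pointwise (ι (f ℚS.* g) n) ((ι f ℝ⟦X⟧.* ι g) n) (λ k → ≡.sym (at-* k (ι f) (ι g) n)))))
  (𝓡.trans (⟦⟧ₛ-* (ι f) (ι g) n)
    (ℝS.*-cong {⟦ ι f ⟧ₛ} {⟦ι f ⟧ₛ} {⟦ ι g ⟧ₛ} {⟦ι g ⟧ₛ} (⟦ι⟧ f) (⟦ι⟧ g) n))

abstract
  Exp : ℚ⟦X⟧ → ℝS.Carrier
  Exp f = ⟦ exp f ⟧ₛ

  ⟦exp⟧ : ∀ f n → ⟦ exp f n ⟧ ≡ Exp f n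
  ⟦exp⟧ f n = ≡.refl

D-Exp : ∀ {f f′} → ℚS.D f ℚS.≈ f′ → ℝS.D (Exp f) ℝS.≈ ⟦ι f′ ⟧ₛ ℝS.* Exp f
D-Exp {f} {f′} Df n = begin
  embed (fromℕ (suc n)) 𝓡.* Exp f (suc n)
    ≡⟨ ≡.cong₂ 𝓡._*_ (⟦fromℚ⟧ (fromℕ (suc n))) (⟦exp⟧ f (suc n)) ⟨
  ⟦ fromℚ (fromℕ (suc n)) ⟧ 𝓡.* ⟦ exp f (suc n) ⟧
    ≈⟨ ⟦⟧-* (fromℚ (fromℕ (suc n))) (exp f (suc n)) ⟨
  ⟦ fromℚ (fromℕ (suc n)) R.* exp f (suc n) ⟧
    ≈⟨ ⟦⟧-cong (fromℚ (fromℕ (suc n)) R.* exp f (suc n)) ((ι f′ ℝ⟦X⟧.* exp f) n)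
         (≈ᴿ-shift (fromℚ (fromℕ (suc n)) R.* exp f (suc n)) ((ι f′ ℝ⟦X⟧.* exp f) n) shift) ⟩
  ⟦ (ι f′ ℝ⟦X⟧.* exp f) n ⟧       ≈⟨ ⟦⟧ₛ-* (ι f′) (exp f) n ⟩
  (⟦ ι f′ ⟧ₛ ℝS.* ⟦ exp f ⟧ₛ) n
    ≈⟨ ℝS.*-cong {⟦ ι f′ ⟧ₛ} {⟦ι f′ ⟧ₛ} {⟦ exp f ⟧ₛ} {Exp f} (⟦ι⟧ f′) (λ m → 𝓡.reflexive (⟦exp⟧ f m)) n ⟩
  (⟦ι f′ ⟧ₛ ℝS.* Exp f) n         ∎
  where
  open import Relation.Binary.Reasoning.Setoid 𝓡.setoid
  shift : ∀ k → approx (fromℚ (fromℕ (suc n)) R.* exp f (suc n)) (suc k) ≡ approx ((ι f′ ℝ⟦X⟧.* exp f) n) k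
  shift k = ≡.trans (D-expₖ f k n)
    (≡.trans (ℚS.*-congʳ {expₖ f k} Df n) (≡.sym (at-* k (ι f′) (exp f) n)))

Exp-*-0 : ∀ f g → ProductOfValuesAt0→1 f g → (Exp f ℝS.* Exp g) 0 𝓡.≈ 𝓡.1#
Exp-*-0 f g h = begin
  Exp f 0 𝓡.* Exp g 0 𝓡.+ 𝓡.0#                 ≈⟨ 𝓡.+-identityʳ (Exp f 0 𝓡.* Exp g 0) ⟩
  Exp f 0 𝓡.* Exp g 0                          ≡⟨ ≡.cong₂ 𝓡._*_ (⟦exp⟧ f 0) (⟦exp⟧ g 0) ⟨
  ⟦ exp f 0 ⟧ 𝓡.* ⟦ exp g 0 ⟧                  ≈⟨ ⟦⟧-* (exp f 0) (exp g 0) ⟨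
  ⟦ exp f 0 R.* exp g 0 ⟧
    ≈⟨ ⟦⟧-pointwise (exp f 0 R.* exp g 0) ((exp f 0 R.* exp g 0) R.+ fromℚ 0ℚ)
         (λ n → ≡.sym (ℚ.+-identityʳ (exp-partial f 0 n ℚ.* exp-partial g 0 n))) ⟩
  ⟦ (exp f 0 R.* exp g 0) R.+ fromℚ 0ℚ ⟧
    ≈⟨ ⟦⟧-cong ((exp f 0 R.* exp g 0) R.+ fromℚ 0ℚ) (fromℚ 1ℚ) h ⟩
  ⟦ fromℚ 1ℚ ⟧                                 ≡⟨ ⟦fromℚ⟧ 1ℚ ⟩
  embed 1ℚ                                     ≡⟨ embed-1 ⟩
  𝓡.1#                                         ∎
  where open import Relation.Binary.Reasoning.Setoid 𝓡.setoid

Exp-inverse : ∀ {f g f′ g′} → ℚS.D f ℚS.≈ f′ → ℚS.D g ℚS.≈ g′ → f′ ℚS.+ g′ ℚS.≈ ℚS.0# →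
              ProductOfValuesAt0→1 f g → Exp f ℝS.* Exp g ℝS.≈ ℝS.1#
Exp-inverse {f} {g} {f′} {g′} Df Dg f′+g′≈0 h =
  ℝS.inverse-solutions {⟦ι f′ ⟧ₛ} {⟦ι g′ ⟧ₛ} {Exp f} {Exp g} (D-Exp {f} Df) (D-Exp {g} Dg)
    (λ n → 𝓡.trans (𝓡.sym (embed-+ (f′ n) (g′ n)))
      (𝓡.reflexive (≡.trans (≡.cong embed (f′+g′≈0 n)) embed-0)))
    (Exp-*-0 f g h)

D-ι : ∀ y g → ℚS.D y ℚS.≈ eˣ ℚS.* y ℚS.+ g →
      ℝS.D ⟦ι y ⟧ₛ ℝS.≈ ⟦ι eˣ ⟧ₛ ℝS.* ⟦ι y ⟧ₛ ℝS.+ ⟦ι g ⟧ₛ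
D-ι y g Dy n = begin
  embed (fromℕ (suc n)) 𝓡.* embed (y (suc n))    ≈⟨ embed-* (fromℕ (suc n)) (y (suc n)) ⟨
  embed (ℚS.D y n)                               ≡⟨ ≡.cong embed (Dy n) ⟩
  embed ((eˣ ℚS.* y) n ℚ.+ g n)                  ≈⟨ embed-+ ((eˣ ℚS.* y) n) (g n) ⟩
  embed ((eˣ ℚS.* y) n) 𝓡.+ embed (g n)          ≈⟨ 𝓡.+-congʳ (ι-* eˣ y n) ⟩
  (⟦ι eˣ ⟧ₛ ℝS.* ⟦ι y ⟧ₛ ℝS.+ ⟦ι g ⟧ₛ) n           ∎
  where open import Relation.Binary.Reasoning.Setoid 𝓡.setoid

-- A record, so that p is read off from the type of a representation instead of
-- being compared with an expected series (which would unfold Cauchy proofs).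
record _Represents_ (P : ℝS.Carrier) (p : ℝ⟦X⟧) : Set where
  constructor represents
  field
    pointwise : ∀ n → ⟦ p n ⟧ 𝓡.≈ P n

open _Represents_

represents-≈ : ∀ {p q P Q} → P Represents p → Q Represents q → P ℝS.≈ Q → p ℝ⟦X⟧.≈ q
represents-≈ {p} {q} rp rq P≈Q n = ⟦⟧-injective (p n) (q n)
  (𝓡.trans (pointwise rp n) (𝓡.trans (P≈Q n) (𝓡.sym (pointwise rq n))))

Exp-represents : ∀ f → Exp f Represents exp f
Exp-represents f = represents λ n → 𝓡.reflexive (⟦exp⟧ f n)

ι-represents : ∀ f → ⟦ι f ⟧ₛ Represents ι f
ι-represents f = represents (⟦ι⟧ f)

*-represents : ∀ {p q P Q} → P Represents p → Q Represents q → (P ℝS.* Q) Represents (p ℝ⟦X⟧.* q)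
*-represents {p} {q} {P} {Q} rp rq = represents λ n → 𝓡.trans (⟦⟧ₛ-* p q n)
  (ℝS.*-cong {⟦ p ⟧ₛ} {P} {⟦ q ⟧ₛ} {Q} (pointwise rp) (pointwise rq) n)

Int : ℝS.Carrier → ℝS.Carrier
Int P zero    = 𝓡.0#
Int P (suc n) = P n 𝓡.* embed (1/suc n)

Int-represents : ∀ {p P} → P Represents p → Int P Represents ∫ p
Int-represents {p} {P} rp = represents λ where
  zero    → 𝓡.reflexive (≡.trans (⟦fromℚ⟧ 0ℚ) embed-0)
  (suc n) → 𝓡.trans (⟦⟧-pointwise (∫ p (suc n)) (p n R.* fromℚ (1/suc n)) (λ _ → ≡.refl))
    (𝓡.trans (⟦⟧-* (p n) (fromℚ (1/suc n))) (𝓡.*-cong (pointwise rp n) (𝓡.reflexive (⟦fromℚ⟧ (1/suc n)))))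

D-Int : ∀ P → ℝS.D (Int P) ℝS.≈ P
D-Int P n = ℝS.ν*[x*μ] n (P n)

solution-by-integral : ∀ {y h f g} → ℚS.D f ℚS.≈ eˣ → Exp f ℝS.* Exp g ℝS.≈ ℝS.1# →
  ℚS.D y ℚS.≈ eˣ ℚS.* y ℚS.+ h → y 0 ≡ 0ℚ →
  ⟦ι y ⟧ₛ ℝS.≈ Exp f ℝS.* Int (Exp g ℝS.* ⟦ι h ⟧ₛ)
solution-by-integral {y} {h} {f} {g} Df fg≈1 Dy y₀ =
  ℝS.D-linear-unique ⟦ι eˣ ⟧ₛ ⟦ι h ⟧ₛ ⟦ι y ⟧ₛ (Exp f ℝS.* J) (D-ι y h Dy)
    (ℝS.variation-of-constants {⟦ι eˣ ⟧ₛ} {⟦ι h ⟧ₛ} {Exp f} {Exp g} {J} (D-Exp {f} Df) fg≈1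
      (D-Int (Exp g ℝS.* ⟦ι h ⟧ₛ)))
    (begin
      embed (y 0)                  ≡⟨ ≡.cong embed y₀ ⟩
      embed 0ℚ                     ≡⟨ embed-0 ⟩
      𝓡.0#                         ≈⟨ 𝓡.zeroʳ (Exp f 0) ⟨
      Exp f 0 𝓡.* 𝓡.0#             ≈⟨ 𝓡.+-identityʳ (Exp f 0 𝓡.* 𝓡.0#) ⟨
      (Exp f ℝS.* J) 0             ∎)
  where
  open import Relation.Binary.Reasoning.Setoid 𝓡.setoid
  J : ℝS.Carrier
  J = Int (Exp g ℝS.* ⟦ι h ⟧ₛ)

solution-by-exp : ∀ {y f} → ℚS.D f ℚS.≈ eˣ → f 0 ≡ 0ℚ → ℚS.D y ℚS.≈ eˣ ℚS.* y → y 0 ≡ 1ℚ → ⟦ι y ⟧ₛ ℝS.≈ Exp f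
solution-by-exp {y} {f} Df f₀ Dy y₀ =
  ℝS.D-linear-unique ⟦ι eˣ ⟧ₛ ⟦ι ℚS.0# ⟧ₛ ⟦ι y ⟧ₛ (Exp f)
    (D-ι y ℚS.0# (ℚS.trans Dy (ℚS.sym (ℚS.+-identityʳ (eˣ ℚS.* y)))))
    (λ m → 𝓡.trans (D-Exp {f} Df m) (𝓡.sym (𝓡.trans (𝓡.+-congˡ (𝓡.reflexive embed-0))
      (𝓡.+-identityʳ ((⟦ι eˣ ⟧ₛ ℝS.* Exp f) m)))))
    (begin
      embed (y 0)        ≡⟨ ≡.cong embed y₀ ⟩
      embed 1ℚ           ≡⟨ ⟦fromℚ⟧ 1ℚ ⟨
      ⟦ fromℚ 1ℚ ⟧       ≈⟨ ⟦⟧-cong (exp f 0) (fromℚ 1ℚ) exp₀ ⟨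
      ⟦ exp f 0 ⟧        ≡⟨ ⟦exp⟧ f 0 ⟩
      Exp f 0            ∎)
  where
  open import Relation.Binary.Reasoning.Setoid 𝓡.setoid
  -- With `f 0` equal to 0, `constants f` solves y′ = 0 and has constant term 1.
  constants-f : constants f ℚS.≈ ℚS.1#
  constants-f = ℚS.D≈0⇒≈1 (λ n → ≡.trans (D-constants f n)
    (≡.trans (≡.cong (ℚ._* constants f n) f₀) (ℚ.*-zeroˡ (constants f n)))) ≡.refl

  sums : ∀ n → exp-partial f 0 (suc n) ≡ 1ℚ
  sums n = ≡.trans (≡.sym (partial-sums f n))
    (≡.trans (ℚS.*-congʳ {geo} constants-f n) (ℚS.*-identityˡ geo n))

  exp₀ : exp f 0 ≈ᴿ fromℚ 1ℚ
  -- The bound 1 skips the empty partial sum, which is 0.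
  exp₀ ε 0<ε = 1 , λ { (suc n) (s≤s _) → ∣p-q∣<ε (sums n) ε 0<ε }

-- Exponential generating functions and the two formulas

egf : (ℕ → ℕ) → ℚ⟦X⟧
egf a n = fromℕ (a n) ℚ.* 1/ n !

D-egf : ∀ a → ℚS.D (egf a) ℚS.≈ egf (a ∘ suc)
D-egf a n = ≡.trans (swap (fromℕ (suc n)) (fromℕ (a (suc n))) (1/ suc n !))
  (≡.cong (fromℕ (a (suc n)) ℚ.*_) (fromℕ*1/! n))
  where
  open +-*-Solver
  swap : ∀ a b c → a ℚ.* (b ℚ.* c) ≡ b ℚ.* (a ℚ.* c)
  swap = solve 3 (λ a b c → a :* (b :* c) := b :* (a :* c)) ≡.refl

-- Differentiating eˣ · `egf a` gives the same product for `a` plus the one for `a ∘ suc`, which is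
-- the recursion defining `binomial-sum`. The sequence `a` therefore varies in the induction.
egf-binomial-sum : ∀ n a → (eˣ ℚS.* egf a) n ≡ egf (λ m → binomial-sum m a) n
egf-binomial-sum zero    a = ≡.trans (ℚ.+-identityʳ (1ℚ ℚ.* egf a 0)) (ℚ.*-identityˡ (egf a 0))
egf-binomial-sum (suc n) a = ν-cancel n {(eˣ * egf a) (suc n)} {egf (λ m → binomial-sum m a) (suc n)} (begin
  D (eˣ * egf a) n                            ≡⟨ D-* eˣ (egf a) n ⟩
  (D eˣ * egf a) n ℚ.+ (eˣ * D (egf a)) n
    ≡⟨ ≡.cong₂ ℚ._+_ (*-congʳ {egf a} D-eˣ n) (*-congˡ {eˣ} (D-egf a) n) ⟩
  (eˣ * egf a) n ℚ.+ (eˣ * egf (a ∘ suc)) n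
    ≡⟨ ≡.cong₂ ℚ._+_ (egf-binomial-sum n a) (egf-binomial-sum n (a ∘ suc)) ⟩
  fromℕ (binomial-sum n a) ℚ.* 1/ n ! ℚ.+ fromℕ (binomial-sum n (a ∘ suc)) ℚ.* 1/ n !
    ≡⟨ ℚ.*-distribʳ-+ (1/ n !) (fromℕ (binomial-sum n a)) (fromℕ (binomial-sum n (a ∘ suc))) ⟨
  (fromℕ (binomial-sum n a) ℚ.+ fromℕ (binomial-sum n (a ∘ suc))) ℚ.* 1/ n !
    ≡⟨ ≡.cong (ℚ._* 1/ n !) (fromℕ-+ (binomial-sum n a) (binomial-sum n (a ∘ suc))) ⟨
  fromℕ (binomial-sum (suc n) a) ℚ.* 1/ n !    ≡⟨ D-egf (λ m → binomial-sum m a) n ⟨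
  D (egf (λ m → binomial-sum m a)) n           ∎)
  where
  open ℚS
  open ℚ-calculus using (ν-cancel)
  open ≡.≡-Reasoning

open ℚ⟦X⟧ using (-_; _-_; 1#)
open ℝ⟦X⟧ using (_≈_; _*_)

D-egf-recurrence : ∀ a δ → (∀ n → a (suc n) ≡ binomial-sum n a ℕ.+ δ n) →
                   ℚS.D (egf a) ℚS.≈ eˣ ℚS.* egf a ℚS.+ egf δ
D-egf-recurrence a δ rec n = begin
  ℚS.D (egf a) n                                 ≡⟨ D-egf a n ⟩
  fromℕ (a (suc n)) ℚ.* 1/ n !                   ≡⟨ ≡.cong (λ m → fromℕ m ℚ.* 1/ n !) (rec n) ⟩
  fromℕ (binomial-sum n a ℕ.+ δ n) ℚ.* 1/ n !    ≡⟨ ≡.cong (ℚ._* 1/ n !) (fromℕ-+ (binomial-sum n a) (δ n)) ⟩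
  (fromℕ (binomial-sum n a) ℚ.+ fromℕ (δ n)) ℚ.* 1/ n !
    ≡⟨ ℚ.*-distribʳ-+ (1/ n !) (fromℕ (binomial-sum n a)) (fromℕ (δ n)) ⟩
  egf (λ m → binomial-sum m a) n ℚ.+ egf δ n     ≡⟨ ≡.cong (ℚ._+ egf δ n) (egf-binomial-sum n a) ⟨
  (eˣ ℚS.* egf a) n ℚ.+ egf δ n                  ∎
  where open ≡.≡-Reasoning

egf-zero : ∀ a {m} → a 0 ≡ m → egf a 0 ≡ fromℕ m
egf-zero a ≡.refl = ℚ.*-identityʳ (fromℕ (a 0))

egf-indicator-from : ∀ m → egf (indicator-from m) ℚS.≈ eˣ-from m
egf-indicator-from m n with m ℕ.≤ᵇ n
... | true  = ℚ.*-identityˡ (1/ n !)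
... | false = ℚ.*-zeroˡ (1/ n !)

Exp-eˣ-represents : Exp eˣ Represents exp eˣ
Exp-eˣ-represents = Exp-represents _

Exp-‿eˣ-represents : Exp (- eˣ) Represents exp (- eˣ)
Exp-‿eˣ-represents = Exp-represents _

Exp-eˣ-1-represents : Exp (eˣ - 1#) Represents exp (eˣ - 1#)
Exp-eˣ-1-represents = Exp-represents _

Exp-eˣ-inverse : Exp eˣ ℝS.* Exp (- eˣ) ℝS.≈ ℝS.1#
Exp-eˣ-inverse = Exp-inverse {eˣ} { - eˣ} { eˣ} { - eˣ} D-eˣ
  (λ n → ≡.trans (D-‿ eˣ n) (≡.cong ℚ.-_ (D-eˣ n)))
  (λ n → ℚ.+-inverseʳ (eˣ n)) e*e⁻¹→1

egf-by-integral : ∀ a m → a 0 ≡ 0 → (∀ n → a (suc n) ≡ binomial-sum n a ℕ.+ indicator-from m n) →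
                  ι (egf a) ≈ exp eˣ * ∫ (exp (- eˣ) * ι (eˣ-from m))
egf-by-integral a m a₀ rec = represents-≈ (ι-represents (egf a))
  (*-represents Exp-eˣ-represents (Int-represents (*-represents Exp-‿eˣ-represents (ι-represents (eˣ-from m)))))
  (solution-by-integral {egf a} {eˣ-from m} {eˣ} { - eˣ} D-eˣ Exp-eˣ-inverse
    (λ n → ≡.trans (D-egf-recurrence a (indicator-from m) rec n)
      (≡.cong ((eˣ ℚS.* egf a) n ℚ.+_) (egf-indicator-from m n)))
    (egf-zero a a₀))

egf-by-exp : ∀ a → a 0 ≡ 1 → (∀ n → a (suc n) ≡ binomial-sum n a) → ι (egf a) ≈ exp (eˣ - 1#)
egf-by-exp a a₀ rec = represents-≈ (ι-represents (egf a)) Exp-eˣ-1-represents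
  (solution-by-exp {egf a} {eˣ - 1#}
    (λ n → ≡.trans (≡.cong (fromℕ (suc n) ℚ.*_) (ℚ.+-identityʳ (eˣ (suc n)))) (D-eˣ n)) ≡.refl
    (λ n → ≡.trans (D-egf-recurrence a (λ _ → 0) (λ n → ≡.trans (rec n) (≡.sym (ℕ.+-identityʳ (binomial-sum n a)))) n)
      (≡.trans (≡.cong ((eˣ ℚS.* egf a) n ℚ.+_) (ℚ.*-zeroˡ (1/ n !))) (ℚ.+-identityʳ ((eˣ ℚS.* egf a) n))))
    (egf-zero a a₀))

proposition5 : (∀ (k : ℕ) → 2 ≤ k →
    E (descending k) ≈ exp eˣ * ∫ (exp (- eˣ) * ι (eˣ-from (k ∸ 1))))
    × (E (descending 1) ≈ exp (eˣ - 1#))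
proposition5 =
  (λ k 2≤k → egf-by-integral (N (descending k)) (k ∸ 1) (Counting.N-zero k 2≤k) (Counting.N-suc k 2≤k)) ,
  egf-by-exp (N (descending 1)) Counting.N₁-zero Counting.N₁-suc
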